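{- Let $R$ be a countable domain, let $\boldsymbol A=(A^{(n)})_{n\in\omega}$ be a tower of countable $R$-modules, and let $\alpha<\omega_1$. Then $$s_\alpha\big({\lim}^1\boldsymbol A\big)={\lim}^1\boldsymbol A_\alpha,$$ where $\boldsymbol A_\alpha$ is the $\alpha$-th derived tower of $\boldsymbol A$ and ${\lim}^1\boldsymbol A_\alpha$ is regarded as a submodule of ${\lim}^1\boldsymbol A$ via the homomorphism induced by the inclusion $\boldsymbol A_\alpha\to\boldsymbol A$.
   Context: A tower of countable modules is a sequence $(A^{(n)})_{n\in\omega}$ of countable modules with homomorphisms $p^{(n,n+1)}:A^{(n+1)}\to A^{(n)}$; $p^{(n,m)}:A^{(m)}\to A^{(n)}$ ($n\le m$) denotes the composite bonding map. For each countable limit ordinal $\lambda$ fix a strictly increasing sequence $(\lambda_n)$ of successor ordinals with supremum $\lambda$; if $\alpha$ is zero or a successor put $\alpha_n=\alpha$ for all $n$. Derived towers. $A_0^{(n)}=A^{(n)}$; for each successor ordinal $\alpha$, $A^{(n)}_\alpha=\bigcap_{k\in\omega}p^{(n,n+k)}\big(A^{(n+k)}_{(\alpha-1)_k}\big)$. For every $\alpha<\omega_1$, $\boldsymbol A_\alpha$ is the tower $(A^{(n)}_{\alpha_n})_{n\in\omega}$. Modules with a Polish cover. A Polish module is an $R$-module that is a Polish abelian group on which each $r\in R$ acts continuously. A module with a Polish cover is $G=\hat G/N$ with $\hat G$ a Polish module and $N$ a Polishable submodule (image of a continuous injective homomorphism from a Polish module). A submodule with a Polish cover is $\hat H/N$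 with $N\subseteq\hat H\subseteq\hat G$ Polishable; its Borel complexity in $G$ is that of $\hat H$ in $\hat G$. $\lim^1\boldsymbol A$ is regarded as the module with a Polish cover $\hat G/N$, where $\hat G=\prod_nA^{(n)}$ (product of discrete modules) and $N$ is the image of $\prod_nA^{(n)}\to\prod_nA^{(n)}$, $(x_n)\mapsto(x_n-p^{(n,n+1)}(x_{n+1}))$. Solecki submodules. $s_0(G)$ is the closure of $\{0\}$ in $G$; $s_1(G)$ is the smallest $\boldsymbol\Pi^0_3$ submodule with a Polish cover of $G$ (it exists); $s_{\alpha+1}(G)=s_1(s_\alpha(G))$; $s_\lambda(G)=\bigcap_{\alpha<\lambda}s_\alpha(G)$ for $\lambda$ limit. -}

module Defs where

open import Level using (0ℓ) renaming (suc to ℓsuc)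
open import Algebra.Bundles using (CommutativeMonoid; CommutativeRing)
open import Algebra.Module.Bundles using (Module)
open import Algebra.Module.Bundles.Raw using (RawModule)
open import Algebra.Module.Morphism.Structures
  using (IsModuleHomomorphism; IsModuleMonomorphism)
import Algebra.Module.Morphism.ModuleMonomorphism as ModuleMonomorphism
open import Algebra.Module.Structures.Biased using (IsModuleFromLeft)
import Algebra.Properties.AbelianGroup as AbelianGroupProperties
import Algebra.Properties.CommutativeSemigroup as CommutativeSemigroupProperties
open import Axiom.ExcludedMiddle using (ExcludedMiddle)
open import Data.Empty using (⊥-elim)
open import Data.Integer.Base as ℤ using (+_; +<+)
open import Data.Nat.Base as ℕ using (ℕ; zero; suc; _+_; _≤_; _<_; z≤n; s≤s; _⊔_)
import Data.Nat.Properties as ℕₚ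
open import Data.Nat.Coprimality using (1-coprimeTo)
open import Data.Product using (Σ; Σ-syntax; ∃; ∃-syntax; _×_; _,_; proj₁; proj₂)
open import Data.Rational.Base as ℚ using (ℚ; 0ℚ; mkℚ)
import Data.Rational.Properties as ℚₚ
open import Data.Sum.Base using (_⊎_; inj₁; inj₂)
open import Function.Base using (_∘_; flip; id)
open import Function.Bundles using (_⇔_; mk⇔)
open import Function.Definitions using (Injective)
open import Induction.WellFounded using (WellFounded; Acc; acc)
open import Relation.Binary.Core using (Rel)
open import Relation.Binary.Definitions using (tri<; tri≈; tri>)
open import Relation.Binary.PropositionalEquality
  using (_≡_; refl; sym; trans; cong; subst)
import Relation.Binary.Reasoning.Setoid as SetoidReasoning
open import Relation.Binary.Structures using (IsStrictTotalOrder)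
open import Relation.Nullary using (¬_; yes; no)
open import Relation.Unary using (Pred; _⊆_; _≐_; _⊢_; ∁; ⋂; ⋃)

Countable : {X : Set} → Rel X 0ℓ → Set
Countable {X} _≈_ = Σ[ e ∈ (ℕ → X) ] (∀ x → ∃[ n ] e n ≈ x)

IsDomain : CommutativeRing 0ℓ 0ℓ → Set
IsDomain R = ¬ (1# ≈ 0#) × (∀ x y → x * y ≈ 0# → x ≈ 0# ⊎ y ≈ 0#)
  where open CommutativeRing R

------------------------------------------------------------------------
-- Countable ordinals

-- A well-ordered set all of whose proper initial segments are countable.
-- Its elements stand for the countable ordinals of the corresponding initial
-- segment of ω₁; every countable ordinal is an element of such a set.

record CountableOrdinals : Set₁ where
  infix 4 _≺_ _⋖_
  field
    Ord                : Set
    _≺_                : Rel Ord 0ℓ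
    isStrictTotalOrder : IsStrictTotalOrder _≡_ _≺_
    wellFounded        : WellFounded _≺_
    countableBelow     : ∀ α → Σ[ e ∈ (ℕ → Ord) ] (∀ β → β ≺ α → ∃[ n ] e n ≡ β)

  open IsStrictTotalOrder isStrictTotalOrder public
    using (compare) renaming (trans to ≺-trans; irrefl to ≺-irrefl)

  IsZero : Ord → Set
  IsZero α = ∀ β → ¬ (β ≺ α)

  -- α = β + 1
  _⋖_ : Ord → Ord → Set
  β ⋖ α = β ≺ α × (∀ γ → β ≺ γ → ¬ (γ ≺ α))

  IsLimit : Ord → Set
  IsLimit α = ¬ IsZero α × (∀ β → ¬ (β ⋖ α))

-- The chosen sequences (λ_n) for limit λ; α [ n ] is α_n.

record FundamentalSequences (O : CountableOrdinals) : Set where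
  open CountableOrdinals O
  infix 9 _[_]
  field
    _[_]       : Ord → ℕ → Ord
    constant   : ∀ {α} n → ¬ IsLimit α → α [ n ] ≡ α
    increasing : ∀ {α} n → IsLimit α → α [ n ] ≺ α [ suc n ]
    successor  : ∀ {α} n → IsLimit α → ∃[ β ] β ⋖ α [ n ]
    below      : ∀ {α} n → IsLimit α → α [ n ] ≺ α
    cofinal    : ∀ {α} β → IsLimit α → β ≺ α → ∃[ n ] β ≺ α [ n ]

------------------------------------------------------------------------
-- Metrics and topologies

-- A metric is given through the upper Dedekind cuts of its values:
-- Near ε x y says that d(x,y) < ε.

record Metric {X : Set} (_≈_ : Rel X 0ℓ) : Set₁ where
  field
    Near      : ℚ → Rel X 0ℓ
    positive  : ∀ {ε x y} → Near ε x y → 0ℚ ℚ.< ε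
    finite    : ∀ x y → ∃[ ε ] Near ε x y
    weaken    : ∀ {δ ε x y} → δ ℚ.< ε → Near δ x y → Near ε x y
    rounded   : ∀ {ε x y} → Near ε x y → ∃[ δ ] (δ ℚ.< ε × Near δ x y)
    separated : ∀ {x y} → (∀ ε → 0ℚ ℚ.< ε → Near ε x y) → x ≈ y
    reflexive : ∀ {ε x y} → 0ℚ ℚ.< ε → x ≈ y → Near ε x y
    symmetric : ∀ {ε x y} → Near ε x y → Near ε y x
    triangle  : ∀ {δ ε x y z} → Near δ x y → Near ε y z → Near (δ ℚ.+ ε) x z

  MetricOpen : Pred X 0ℓ → Set
  MetricOpen U = ∀ {x} → U x → ∃[ ε ] (0ℚ ℚ.< ε × (∀ {y} → Near ε x y → U y))

  Cauchy : (ℕ → X) → Set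
  Cauchy s = ∀ ε → 0ℚ ℚ.< ε → ∃[ N ] (∀ i j → N ≤ i → N ≤ j → Near ε (s i) (s j))

  _ConvergesTo_ : (ℕ → X) → X → Set
  s ConvergesTo x = ∀ ε → 0ℚ ℚ.< ε → ∃[ N ] (∀ i → N ≤ i → Near ε (s i) x)

  Complete : Set
  Complete = ∀ s → Cauchy s → ∃[ x ] s ConvergesTo x

  Separable : Set
  Separable = Σ[ s ∈ (ℕ → X) ] (∀ x ε → 0ℚ ℚ.< ε → ∃[ n ] Near ε (s n) x)

Topology : Set → Set₁
Topology X = Pred X 0ℓ → Set

Continuous : {X Y : Set} → Topology X → Topology Y → (X → Y) → Set₁
Continuous OpenX OpenY f = ∀ U → OpenY U → OpenX (f ⊢ U)

Continuous₂ : {X : Set} → Topology X → (X → X → X) → Set₁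
Continuous₂ {X} Open _∙_ = ∀ U x y → Open U → U (x ∙ y) →
  Σ[ V ∈ Pred X 0ℓ ] Σ[ W ∈ Pred X 0ℓ ]
    Open V × Open W × V x × W y × (∀ {x′ y′} → V x′ → W y′ → U (x′ ∙ y′))

module _ {X : Set} (Open : Topology X) where

  Closed : Pred X 0ℓ → Set
  Closed F = Open (∁ F)

  Σ⁰₂ : Pred X 0ℓ → Set₁
  Σ⁰₂ S = Σ[ F ∈ (ℕ → Pred X 0ℓ) ] (∀ n → Closed (F n)) × S ≐ ⋃ ℕ F

  Π⁰₃ : Pred X 0ℓ → Set₁
  Π⁰₃ S = Σ[ F ∈ (ℕ → Pred X 0ℓ) ] (∀ n → Σ⁰₂ (F n)) × S ≐ ⋂ ℕ F

------------------------------------------------------------------------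
-- Modules

Mod : CommutativeRing 0ℓ 0ℓ → Set₁
Mod R = Module R 0ℓ 0ℓ

∣_∣ : ∀ {R} → Mod R → Set
∣ M ∣ = Module.Carrierᴹ M

module _ {R : CommutativeRing 0ℓ 0ℓ} where

  private module R = CommutativeRing R

  record Hom (M N : Mod R) : Set where
    field
      ⟦_⟧            : ∣ M ∣ → ∣ N ∣
      isHomomorphism : IsModuleHomomorphism (Module.rawModule M) (Module.rawModule N) ⟦_⟧
    open IsModuleHomomorphism isHomomorphism public

  open Hom public using (⟦_⟧)

  Image : {M N : Mod R} → Hom M N → Pred ∣ N ∣ 0ℓ
  Image {M} {N} f y = ∃[ x ] ⟦ f ⟧ x ≈ᴹ y
    where open Module N

  Inj : {M N : Mod R} → Hom M N → Set
  Inj {M} {N} f = Injective (Module._≈ᴹ_ M) (Module._≈ᴹ_ N) ⟦ f ⟧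

  mkHom : {M N : Mod R} →
          let open Module M using () renaming (_≈ᴹ_ to _≈₁_; _+ᴹ_ to _+₁_; _*ₗ_ to _*₁_)
              open Module N using () renaming (_≈ᴹ_ to _≈₂_; _+ᴹ_ to _+₂_; _*ₗ_ to _*₂_)
          in (f : ∣ M ∣ → ∣ N ∣) →
          (∀ {x y} → x ≈₁ y → f x ≈₂ f y) →
          (∀ x y → f (x +₁ y) ≈₂ (f x +₂ f y)) →
          (∀ r x → f (r *₁ x) ≈₂ (r *₂ f x)) →
          Hom M N
  mkHom {M} {N} f f-cong f-+ f-* = record
    { ⟦_⟧ = f
    ; isHomomorphism = record
      { isBimoduleHomomorphism = record
        { +ᴹ-isGroupHomomorphism = record
          { isMonoidHomomorphism = record
            { isMagmaHomomorphism = record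
              { isRelHomomorphism = record { cong = f-cong }
              ; homo = f-+ }
            ; ε-homo = f-0 }
          ; ⁻¹-homo = f-neg }
        ; *ₗ-homo = f-*
        ; *ᵣ-homo = λ r x →
            N.≈ᴹ-trans (f-cong (M.≈ᴹ-sym (M.*ₗ-*ᵣ-coincident r x)))
            (N.≈ᴹ-trans (f-* r x) (N.*ₗ-*ᵣ-coincident r (f x)))
        }
      }
    }
    where
    module M = Module M
    module N = Module N
    open AbelianGroupProperties N.+ᴹ-abelianGroup using (identityʳ-unique; inverseʳ-unique)
    f-0 : f M.0ᴹ N.≈ᴹ N.0ᴹ
    f-0 = identityʳ-unique (f M.0ᴹ) (f M.0ᴹ)
      (N.≈ᴹ-trans (N.≈ᴹ-sym (f-+ M.0ᴹ M.0ᴹ)) (f-cong (M.+ᴹ-identityʳ M.0ᴹ)))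
    f-neg : ∀ x → f (M.-ᴹ x) N.≈ᴹ N.-ᴹ f x
    f-neg x = inverseʳ-unique (f x) (f (M.-ᴹ x))
      (N.≈ᴹ-trans (N.≈ᴹ-sym (f-+ x (M.-ᴹ x)))
        (N.≈ᴹ-trans (f-cong (M.-ᴹ‿inverseʳ x)) f-0))

  -- The module structure on X for which ι : X → M is a homomorphism and
  -- elements with equal images are identified.

  inducedModule : (M : Mod R) → let open Module M in
                  {X : Set} (ι : X → ∣ M ∣)
                  (o : X) (_⊕_ : X → X → X) (⊖_ : X → X) (_⊛_ : R.Carrier → X → X) →
                  ι o ≈ᴹ 0ᴹ → (∀ x y → ι (x ⊕ y) ≈ᴹ ι x +ᴹ ι y) →
                  (∀ x → ι (⊖ x) ≈ᴹ -ᴹ ι x) → (∀ r x → ι (r ⊛ x) ≈ᴹ r *ₗ ι x) → Mod R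
  inducedModule M {X} ι o _⊕_ ⊖_ _⊛_ ι-0 ι-+ ι-neg ι-* = record
    { Carrierᴹ = X
    ; _≈ᴹ_ = λ x y → ι x ≈ᴹ ι y
    ; _+ᴹ_ = _⊕_
    ; _*ₗ_ = _⊛_
    ; _*ᵣ_ = flip _⊛_
    ; 0ᴹ = o
    ; -ᴹ_ = ⊖_
    ; isModule = ModuleMonomorphism.isModule mono R.isCommutativeRing isModule
    }
    where
    open Module M
    raw : RawModule R.Carrier 0ℓ 0ℓ
    raw = record
      { Carrierᴹ = X ; _≈ᴹ_ = λ x y → ι x ≈ᴹ ι y ; _+ᴹ_ = _⊕_
      ; _*ₗ_ = _⊛_ ; _*ᵣ_ = flip _⊛_ ; 0ᴹ = o ; -ᴹ_ = ⊖_ }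
    mono : IsModuleMonomorphism raw rawModule ι
    mono = record
      { isModuleHomomorphism = record
        { isBimoduleHomomorphism = record
          { +ᴹ-isGroupHomomorphism = record
            { isMonoidHomomorphism = record
              { isMagmaHomomorphism = record
                { isRelHomomorphism = record { cong = id }
                ; homo = ι-+ }
              ; ε-homo = ι-0 }
            ; ⁻¹-homo = ι-neg }
          ; *ₗ-homo = ι-*
          ; *ᵣ-homo = λ r x → ≈ᴹ-trans (ι-* r x) (*ₗ-*ᵣ-coincident r (ι x))
          }
        }
      ; injective = id
      }

  record Submodule (M : Mod R) : Set₁ where
    open Module M
    field
      Mem      : Pred ∣ M ∣ 0ℓ
      resp     : ∀ {x y} → x ≈ᴹ y → Mem x → Mem y
      0-mem    : Mem 0ᴹ
      +-mem    : ∀ {x y} → Mem x → Mem y → Mem (x +ᴹ y)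
      neg-mem  : ∀ {x} → Mem x → Mem (-ᴹ x)
      *ₗ-mem   : ∀ r {x} → Mem x → Mem (r *ₗ x)

  toModule : {M : Mod R} → Submodule M → Mod R
  toModule {M} S = inducedModule M {Σ ∣ M ∣ Mem} proj₁
    (0ᴹ , 0-mem)
    (λ (x , p) (y , q) → x +ᴹ y , +-mem p q)
    (λ (x , p) → -ᴹ x , neg-mem p)
    (λ r (x , p) → r *ₗ x , *ₗ-mem r p)
    ≈ᴹ-refl (λ _ _ → ≈ᴹ-refl) (λ _ → ≈ᴹ-refl) (λ _ _ → ≈ᴹ-refl)
    where
    open Module M
    open Submodule S

  ∏ : (ℕ → Mod R) → Mod R
  ∏ A = record
    { Carrierᴹ = ∀ n → ∣ A n ∣
    ; _≈ᴹ_ = λ x y → ∀ n → A._≈ᴹ_ n (x n) (y n)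
    ; _+ᴹ_ = λ x y n → A._+ᴹ_ n (x n) (y n)
    ; _*ₗ_ = λ r x n → A._*ₗ_ n r (x n)
    ; _*ᵣ_ = λ x r n → A._*ₗ_ n r (x n)
    ; 0ᴹ = λ n → A.0ᴹ n
    ; -ᴹ_ = λ x n → A.-ᴹ_ n (x n)
    ; isModule = IsModuleFromLeft.isModule (record
      { isLeftModule = record
        { isLeftSemimodule = record
          { +ᴹ-isCommutativeMonoid = record
            { isMonoid = record
              { isSemigroup = record
                { isMagma = record
                  { isEquivalence = record
                    { refl = λ n → A.≈ᴹ-refl n
                    ; sym = λ p n → A.≈ᴹ-sym n (p n)
                    ; trans = λ p q n → A.≈ᴹ-trans n (p n) (q n) }
                  ; ∙-cong = λ p q n → A.+ᴹ-cong n (p n) (q n) }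
                ; assoc = λ x y z n → A.+ᴹ-assoc n (x n) (y n) (z n) }
              ; identity = (λ x n → A.+ᴹ-identityˡ n (x n))
                         , (λ x n → A.+ᴹ-identityʳ n (x n)) }
            ; comm = λ x y n → A.+ᴹ-comm n (x n) (y n) }
          ; isPreleftSemimodule = record
            { *ₗ-cong = λ p q n → A.*ₗ-cong n p (q n)
            ; *ₗ-zeroˡ = λ x n → A.*ₗ-zeroˡ n (x n)
            ; *ₗ-distribʳ = λ x r s n → A.*ₗ-distribʳ n (x n) r s
            ; *ₗ-identityˡ = λ x n → A.*ₗ-identityˡ n (x n)
            ; *ₗ-assoc = λ r s x n → A.*ₗ-assoc n r s (x n)
            ; *ₗ-zeroʳ = λ r n → A.*ₗ-zeroʳ n r
            ; *ₗ-distribˡ = λ r x y n → A.*ₗ-distribˡ n r (x n) (y n)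
            }
          }
        ; -ᴹ‿cong = λ p n → A.-ᴹ‿cong n (p n)
        ; -ᴹ‿inverse = (λ x n → A.-ᴹ‿inverseˡ n (x n)) , (λ x n → A.-ᴹ‿inverseʳ n (x n))
        }
      })
    }
    where
    module A n = Module (A n)

------------------------------------------------------------------------
-- Modules with a Polish cover

record PolishModule (R : CommutativeRing 0ℓ 0ℓ) : Set₁ where
  field
    mod           : Mod R
  open Module mod public
  open CommutativeRing R public using () renaming (Carrier to Scalar)
  field
    Open          : Topology Carrierᴹ
    metric        : Metric _≈ᴹ_
    metrizes      : ∀ U → Open U ⇔ Metric.MetricOpen metric U
    complete      : Metric.Complete metric
    separable     : Metric.Separable metric
    +-continuous  : Continuous₂ Open _+ᴹ_
    neg-continuous : Continuous Open Open -ᴹ_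
    *ₗ-continuous : ∀ (r : Scalar) → Continuous Open Open (r *ₗ_)

module _ {R : CommutativeRing 0ℓ 0ℓ} where

  open PolishModule using (mod; Open)

  record ContinuousInjection (P Q : PolishModule R) : Set₁ where
    field
      hom        : Hom (mod P) (mod Q)
      continuous : Continuous (Open P) (Open Q) ⟦ hom ⟧
      injective  : Inj hom

  open ContinuousInjection using (hom)

  Polishable : (P : PolishModule R) → Pred ∣ mod P ∣ 0ℓ → Set₁
  Polishable P N = Σ[ Q ∈ PolishModule R ] Σ[ f ∈ ContinuousInjection Q P ] N ≐ Image (hom f)

record PolishCover (R : CommutativeRing 0ℓ 0ℓ) : Set₁ where
  field
    cover      : PolishModule R
    N          : Pred ∣ PolishModule.mod cover ∣ 0ℓ
    polishable : Polishable cover N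

  open PolishModule cover public
    using () renaming (Carrierᴹ to Ĝ; mod to Ĝ-mod; Open to Ĝ-Open)

  -- Equality in the quotient Ĝ/N.
  infix 4 _∼_
  _∼_ : Rel Ĝ 0ℓ
  x ∼ y = N (x +ᴹ (-ᴹ y))
    where open PolishModule cover

  -- The closure of {0} in the quotient topology: the open sets of Ĝ/N are the
  -- open subsets of Ĝ that are invariant under _∼_.
  ClosureOfZero : Pred Ĝ (ℓsuc 0ℓ)
  ClosureOfZero x =
    ∀ U → Ĝ-Open U → (∀ {y z} → y ∼ z → U y → U z) → U x → U (Module.0ᴹ Ĝ-mod)

module _ {R : CommutativeRing 0ℓ 0ℓ} where

  open PolishCover

  -- Submodules of Ĝ/N are represented by the submodules of Ĝ containing N.

  IsPolishSubmodule : (G : PolishCover R) → Pred (Ĝ G) 0ℓ → Set₁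
  IsPolishSubmodule G H = Polishable (cover G) H × N G ⊆ H

  -- H/N = s₁(Ĝ/N)
  IsS₁ : (G : PolishCover R) → Pred (Ĝ G) 0ℓ → Set₁
  IsS₁ G H = (IsPolishSubmodule G H × Π⁰₃ (Ĝ-Open G) H)
           × (∀ H′ → IsPolishSubmodule G H′ × Π⁰₃ (Ĝ-Open G) H′ → H ⊆ H′)

  -- A submodule with a Polish cover, regarded as a module with a Polish cover
  -- in its own right.  The Polish topology of `sub` is the one witnessing that
  -- the image of ι is Polishable; it is unique.
  record SubCover (G : PolishCover R) : Set₁ where
    field
      sub      : PolishCover R
      ι        : ContinuousInjection (cover sub) (cover G)
      contains : N G ⊆ Image (ContinuousInjection.hom ι)
      same-N   : N sub ≐ (⟦ ContinuousInjection.hom ι ⟧ ⊢ N G)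

    Ĥ : Pred (Ĝ G) 0ℓ
    Ĥ = Image (ContinuousInjection.hom ι)

    push : Pred (Ĝ sub) 0ℓ → Pred (Ĝ G) 0ℓ
    push K y = ∃[ x ] (K x × ⟦ ContinuousInjection.hom ι ⟧ x ≈ᴹ y)
      where open PolishModule (cover G)

module _ {R : CommutativeRing 0ℓ 0ℓ} (O : CountableOrdinals) where

  open CountableOrdinals O
  open PolishCover

  -- IsSolecki O G α H says that H/N = s_α(Ĝ/N).  At successors S is s_β(G) as a
  -- module with a Polish cover, and s₁(S) is transported back to Ĝ.
  data IsSolecki (G : PolishCover R) : Ord → Pred (Ĝ G) 0ℓ → Set₁ where
    s-zero  : ∀ {α H} → IsZero α →
              H ≐ ClosureOfZero G →
              IsSolecki G α H
    s-suc   : ∀ {α β H K} → β ⋖ α →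
              IsSolecki G β K →
              (S : SubCover G) → K ≐ SubCover.Ĥ S →
              (L : Pred (Ĝ (SubCover.sub S)) 0ℓ) → IsS₁ (SubCover.sub S) L →
              H ≐ SubCover.push S L →
              IsSolecki G α H
    s-limit : ∀ {α H} → IsLimit α →
              (K : ∀ β → β ≺ α → Pred (Ĝ G) 0ℓ) →
              (∀ β (β≺α : β ≺ α) → IsSolecki G β (K β β≺α)) →
              H ≐ (λ x → ∀ β (β≺α : β ≺ α) → K β β≺α x) →
              IsSolecki G α H

------------------------------------------------------------------------
-- Polish modules from complete separable filtrations

-- E n x y reads "d(x,y) ≤ 1/(n+1)" for an invariant ultrametric d ≤ 1.

record Filtration {R : CommutativeRing 0ℓ 0ℓ} (M : Mod R) : Set₁ where
  open Module M
  field
    E         : ℕ → Rel ∣ M ∣ 0ℓ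
    E-refl    : ∀ {n x y} → x ≈ᴹ y → E n x y
    E-sym     : ∀ {n x y} → E n x y → E n y x
    E-trans   : ∀ {n x y z} → E n x y → E n y z → E n x z
    E-zero    : ∀ {x y} → E 0 x y
    E-≤       : ∀ {m n x y} → m ≤ n → E n x y → E m x y
    E-sep     : ∀ {x y} → (∀ n → E n x y) → x ≈ᴹ y
    E-+       : ∀ {n x x′ y y′} → E n x x′ → E n y y′ → E n (x +ᴹ y) (x′ +ᴹ y′)
    E-neg     : ∀ {n x y} → E n x y → E n (-ᴹ x) (-ᴹ y)
    E-*       : ∀ {n x y} r → E n x y → E n (r *ₗ x) (r *ₗ y)
    E-limit   : (s : ℕ → ∣ M ∣) → (∀ k → E k (s k) (s (suc k))) → ∃[ x ] (∀ k → E k (s k) x)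
    E-dense   : Σ[ s ∈ (ℕ → ∣ M ∣) ] (∀ x n → ∃[ k ] E n (s k) x)

  FOpen : Topology ∣ M ∣
  FOpen U = ∀ {x} → U x → ∃[ n ] (∀ {y} → E n x y → U y)

1/1+ : ℕ → ℚ
1/1+ n = mkℚ (+ 1) n (1-coprimeTo (suc n))

0<1/1+ : ∀ n → 0ℚ ℚ.< 1/1+ n
0<1/1+ n = ℚₚ.positive⁻¹ (1/1+ n)

1/1+-antitone : ∀ {m n} → 1/1+ m ℚ.< 1/1+ n → n ≤ m
1/1+-antitone {m} {n} (ℚ.*<* (+<+ p)) =
  ℕₚ.≤-pred (ℕₚ.<⇒≤ (ℕₚ.≤-<-trans (ℕₚ.≤-reflexive (sym (ℕₚ.*-identityˡ (suc n))))
    (ℕₚ.<-≤-trans p (ℕₚ.≤-reflexive (ℕₚ.*-identityˡ (suc m))))))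

archimedean : ∀ {ε} → 0ℚ ℚ.< ε → ∃[ n ] 1/1+ n ℚ.< ε
archimedean {mkℚ (+ 0) q c} (ℚ.*<* (+<+ ()))
archimedean {mkℚ (+ suc p) q c} _ = suc q , ℚ.*<* (+<+ (
  ℕₚ.<-≤-trans (ℕₚ.≤-<-trans (ℕₚ.≤-reflexive (ℕₚ.*-identityˡ (suc q))) (ℕₚ.n<1+n (suc q)))
    (ℕₚ.m≤m+n (suc (suc q)) (p ℕ.* suc (suc q)))))
archimedean {mkℚ ℤ.-[1+ p ] q c} (ℚ.*<* ())

module _ {R : CommutativeRing 0ℓ 0ℓ} {M : Mod R} (F : Filtration M) where

  open Module M
  open Filtration F

  filtrationMetric : Metric _≈ᴹ_
  filtrationMetric = record
    { Near = λ ε x y → ∃[ n ] (1/1+ n ℚ.< ε × E n x y)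
    ; positive = λ (n , p , _) → ℚₚ.<-trans (0<1/1+ n) p
    ; finite = λ _ _ → ℚ.1ℚ ℚ.+ ℚ.1ℚ , 0 , ℚ.*<* (+<+ (s≤s (s≤s z≤n))) , E-zero
    ; weaken = λ δ<ε (n , p , e) → n , ℚₚ.<-trans p δ<ε , e
    ; rounded = λ (n , p , e) → let (δ , q , r) = ℚₚ.<-dense p in δ , r , n , q , e
    ; separated = λ h → E-sep λ n → let (m , p , e) = h (1/1+ n) (0<1/1+ n) in
        E-≤ (1/1+-antitone p) e
    ; reflexive = λ 0<ε x≈y → let (n , p) = archimedean 0<ε in n , p , E-refl x≈y
    ; symmetric = λ (n , p , e) → n , p , E-sym e
    ; triangle = triangle
    }
    where
    triangle : ∀ {δ ε x y z} → ∃[ n ] (1/1+ n ℚ.< δ × E n x y) →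
               ∃[ n ] (1/1+ n ℚ.< ε × E n y z) → ∃[ n ] (1/1+ n ℚ.< δ ℚ.+ ε × E n x z)
    triangle {δ} {ε} (m , p , d) (n , q , e) with ℕₚ.≤-total m n
    ... | inj₁ m≤n = m , ℚₚ.<-trans p δ<δ+ε , E-trans d (E-≤ m≤n e)
      where
      δ<δ+ε : δ ℚ.< δ ℚ.+ ε
      δ<δ+ε = subst (ℚ._< δ ℚ.+ ε) (ℚₚ.+-identityʳ δ)
        (ℚₚ.+-monoʳ-< δ (ℚₚ.<-trans (0<1/1+ n) q))
    ... | inj₂ n≤m = n , ℚₚ.<-trans q ε<δ+ε , E-trans (E-≤ n≤m d) e
      where
      ε<δ+ε : ε ℚ.< δ ℚ.+ ε
      ε<δ+ε = subst (ℚ._< δ ℚ.+ ε) (ℚₚ.+-identityˡ ε)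
        (ℚₚ.+-monoˡ-< ε (ℚₚ.<-trans (0<1/1+ m) p))

  open Metric filtrationMetric using (MetricOpen; Complete; Cauchy; _ConvergesTo_)

  filtrationComplete : Complete
  filtrationComplete s cauchy = x , converges
    where
    N : ℕ → ℕ
    N k = proj₁ (cauchy (1/1+ k) (0<1/1+ k))
    K : ℕ → ℕ
    K zero = N 0
    K (suc k) = K k ⊔ N (suc k)
    N≤K : ∀ k → N k ≤ K k
    N≤K zero = ℕₚ.≤-refl
    N≤K (suc k) = ℕₚ.m≤n⊔m (K k) (N (suc k))
    close : ∀ k i j → N k ≤ i → N k ≤ j → E k (s i) (s j)
    close k i j p q = let (n , r , e) = proj₂ (cauchy (1/1+ k) (0<1/1+ k)) i j p q in
      E-≤ (1/1+-antitone r) e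
    lim : ∃[ x ] (∀ k → E k (s (K k)) x)
    lim = E-limit (s ∘ K) λ k →
      close k (K k) (K (suc k)) (N≤K k) (ℕₚ.≤-trans (N≤K k) (ℕₚ.m≤m⊔n (K k) (N (suc k))))
    x : ∣ M ∣
    x = proj₁ lim
    converges : s ConvergesTo x
    converges ε 0<ε = let (n , p) = archimedean 0<ε in
      K n , λ i K≤i → n , p ,
        E-trans (close n i (K n) (ℕₚ.≤-trans (N≤K n) K≤i) (N≤K n)) (proj₂ lim n)

  filtrationPolish : PolishModule R
  filtrationPolish = record
    { mod = M
    ; Open = FOpen
    ; metric = filtrationMetric
    ; metrizes = λ U → mk⇔ (to U) (from U)
    ; complete = filtrationComplete
    ; separable = proj₁ E-dense , λ x ε 0<ε →
        let (n , p) = archimedean 0<ε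
            (k , e) = proj₂ E-dense x n in k , n , p , e
    ; +-continuous = +-cts
    ; neg-continuous = λ U open-U Ux → let (n , h) = open-U Ux in n , λ e → h (E-neg e)
    ; *ₗ-continuous = λ r U open-U Ux → let (n , h) = open-U Ux in n , λ e → h (E-* r e)
    }
    where
    to : ∀ U → FOpen U → MetricOpen U
    to U open-U Ux = let (n , h) = open-U Ux in
      1/1+ n , 0<1/1+ n , λ (m , q , e) → h (E-≤ (1/1+-antitone q) e)
    from : ∀ U → MetricOpen U → FOpen U
    from U open-U Ux =
      let (ε , 0<ε , h) = open-U Ux
          (n , p) = archimedean 0<ε in
      n , λ e → h (n , p , e)
    ball-open : ∀ n x → FOpen (E n x)
    ball-open n x e = n , E-trans e
    +-cts : Continuous₂ FOpen _+ᴹ_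
    +-cts U x y open-U Uxy = let (n , h) = open-U Uxy in
      E n x , E n y , ball-open n x , ball-open n y
      , E-refl ≈ᴹ-refl , E-refl ≈ᴹ-refl , λ e e′ → h (E-+ e e′)

------------------------------------------------------------------------
-- Products of countable modules

unpair : ℕ → ℕ × ℕ
unpair zero = 0 , 0
unpair (suc n) with unpair n
... | zero  , b = suc b , 0
... | suc a , b = a , suc b

unpair-surjective : ∀ a b → ∃[ n ] unpair n ≡ (a , b)
unpair-surjective a b = diagonal (a + b) a b refl
  where
  diagonal : ∀ s a b → a + b ≡ s → ∃[ n ] unpair n ≡ (a , b)
  diagonal zero    zero    zero    _ = 0 , refl
  diagonal (suc s) (suc a) zero    e = n , eq
    where
    prev = diagonal s 0 s refl
    n = suc (proj₁ prev)
    eq : unpair n ≡ (suc a , 0)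
    eq rewrite proj₂ prev | sym (ℕₚ.suc-injective e) | ℕₚ.+-identityʳ a = refl
  diagonal s       a       (suc b) e = n , eq
    where
    prev = diagonal s (suc a) b (trans (sym (ℕₚ.+-suc a b)) e)
    n = suc (proj₁ prev)
    eq : unpair n ≡ (a , suc b)
    eq rewrite proj₂ prev = refl

digit : ℕ → ℕ → ℕ
digit k zero    = proj₁ (unpair k)
digit k (suc i) = digit (proj₂ (unpair k)) i

digit-dense : ∀ (c : ℕ → ℕ) n → ∃[ k ] (∀ i → i < n → digit k i ≡ c i)
digit-dense c zero = 0 , λ _ ()
digit-dense c (suc n) = k , agree
  where
  rest = digit-dense (c ∘ suc) n
  code = unpair-surjective (c 0) (proj₁ rest)
  k = proj₁ code
  agree : ∀ i → i < suc n → digit k i ≡ c i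
  agree zero _ = cong proj₁ (proj₂ code)
  agree (suc i) (s≤s i<n) =
    trans (cong (λ z → digit (proj₂ z) i) (proj₂ code)) (proj₂ rest i i<n)

module _ {R : CommutativeRing 0ℓ 0ℓ} (A : ℕ → Mod R)
         (countable : ∀ n → Countable (Module._≈ᴹ_ (A n))) where

  private module A n = Module (A n)

  -- The open sets of the resulting topology are those containing, with each x,
  -- every y that agrees with x on a suitable finite set of coordinates: this is
  -- the product of the discrete topologies.
  ∏-filtration : Filtration (∏ A)
  ∏-filtration = record
    { E = λ n x y → ∀ i → i < n → A._≈ᴹ_ i (x i) (y i)
    ; E-refl = λ e i _ → e i
    ; E-sym = λ e i i<n → A.≈ᴹ-sym i (e i i<n)
    ; E-trans = λ e e′ i i<n → A.≈ᴹ-trans i (e i i<n) (e′ i i<n)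
    ; E-zero = λ _ ()
    ; E-≤ = λ m≤n e i i<m → e i (ℕₚ.<-≤-trans i<m m≤n)
    ; E-sep = λ e i → e (suc i) i (ℕₚ.n<1+n i)
    ; E-+ = λ e e′ i i<n → A.+ᴹ-cong i (e i i<n) (e′ i i<n)
    ; E-neg = λ e i i<n → A.-ᴹ‿cong i (e i i<n)
    ; E-* = λ r e i i<n → A.*ₗ-cong i (CommutativeRing.refl R) (e i i<n)
    ; E-limit = λ s step → (λ i → s (suc i) i) , λ k i i<k → stable s step i k i<k
    ; E-dense = (λ k i → proj₁ (countable i) (digit k i)) , dense
    }
    where
    stable : ∀ (s : ℕ → ∣ ∏ A ∣) →
             (∀ k i → i < k → A._≈ᴹ_ i (s k i) (s (suc k) i)) →
             ∀ i k → i < k → A._≈ᴹ_ i (s k i) (s (suc i) i)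
    stable s step i (suc k) (s≤s i≤k) with ℕₚ.m≤n⇒m<n∨m≡n i≤k
    ... | inj₂ refl = A.≈ᴹ-refl i
    ... | inj₁ i<k = A.≈ᴹ-trans i (A.≈ᴹ-sym i (step k i i<k)) (stable s step i k i<k)
    dense : ∀ (x : ∣ ∏ A ∣) n →
            ∃[ k ] (∀ i → i < n → A._≈ᴹ_ i (proj₁ (countable i) (digit k i)) (x i))
    dense x n =
      let (k , agree) = digit-dense (λ i → proj₁ (proj₂ (countable i) (x i))) n in
      k , λ i i<n → subst (λ m → A._≈ᴹ_ i (proj₁ (countable i) m) (x i))
        (sym (agree i i<n)) (proj₂ (proj₂ (countable i) (x i)))

------------------------------------------------------------------------
-- Images of uniformly continuous homomorphisms are Polishable

module _ {R : CommutativeRing 0ℓ 0ℓ} {M M′ : Mod R} (F : Filtration M) (F′ : Filtration M′)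
         (f : Hom M M′) where

  private
    module M = Module M
    module M′ = Module M′
    module F = Filtration F
    module F′ = Filtration F′
    module f = Hom f

  -- M modulo the kernel of f.
  coimage : Mod R
  coimage = inducedModule M′ ⟦ f ⟧ M.0ᴹ M._+ᴹ_ M.-ᴹ_ M._*ₗ_
    f.0ᴹ-homo f.+ᴹ-homo f.-ᴹ-homo f.*ₗ-homo

  module _ (uniform : ∀ m → ∃[ n ] (∀ {x y} → F.E n x y → F′.E m (⟦ f ⟧ x) (⟦ f ⟧ y))) where

    private
      open Module coimage using () renaming (_≈ᴹ_ to _≋_; ≈ᴹ-refl to ≋-refl; ≈ᴹ-sym to ≋-sym;
        ≈ᴹ-trans to ≋-trans; +ᴹ-cong to ≋-+; -ᴹ‿cong to ≋-neg; *ₗ-cong to ≋-*)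

      E : ℕ → Rel ∣ M ∣ 0ℓ
      E n x y = ∃[ x′ ] (x′ ≋ x × F.E n x′ y)

      shift : ∀ u v → (u M.+ᴹ (v M.+ᴹ M.-ᴹ u)) M.≈ᴹ v
      shift u v = begin
        u M.+ᴹ (v M.+ᴹ M.-ᴹ u) ≈⟨ M.+ᴹ-congˡ (M.+ᴹ-comm v (M.-ᴹ u)) ⟩
        u M.+ᴹ (M.-ᴹ u M.+ᴹ v) ≈⟨ M.+ᴹ-assoc u (M.-ᴹ u) v ⟨
        (u M.+ᴹ M.-ᴹ u) M.+ᴹ v ≈⟨ M.+ᴹ-congʳ (M.-ᴹ‿inverseʳ u) ⟩
        M.0ᴹ M.+ᴹ v            ≈⟨ M.+ᴹ-identityˡ v ⟩
        v                      ∎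
        where open SetoidReasoning M.≈ᴹ-setoid

      -- Translate along the kernel.
      translate : ∀ {n u v w} → F.E n u v → w ≋ v → ∃[ u′ ] (u′ ≋ u × F.E n u′ w)
      translate {n} {u} {v} {w} e w≋v = u M.+ᴹ d , eq , F.E-trans (F.E-+ e (F.E-refl M.≈ᴹ-refl))
          (F.E-refl (shift v w))
        where
        d = w M.+ᴹ M.-ᴹ v
        d≋0 : d ≋ M.0ᴹ
        d≋0 = ≋-trans (≋-+ w≋v (≋-refl {M.-ᴹ v})) (f.⟦⟧-cong (M.-ᴹ‿inverseʳ v))
        eq : (u M.+ᴹ d) ≋ u
        eq = ≋-trans (≋-+ (≋-refl {u}) d≋0) (f.⟦⟧-cong (M.+ᴹ-identityʳ u))

      image-close : ∀ {x y} m → E (proj₁ (uniform m)) x y → F′.E m (⟦ f ⟧ x) (⟦ f ⟧ y)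
      image-close m (x′ , x′≋x , e) =
        F′.E-trans (F′.E-refl (M′.≈ᴹ-sym x′≋x)) (proj₂ (uniform m) e)

      E-sym : ∀ {n x y} → E n x y → E n y x
      E-sym (x′ , x′≋x , e) = translate (F.E-sym e) (≋-sym x′≋x)

      E-trans : ∀ {n x y z} → E n x y → E n y z → E n x z
      E-trans (x′ , x′≋x , d) (y′ , y′≋y , e) =
        let (x″ , x″≋x′ , d′) = translate d y′≋y in
        x″ , ≋-trans x″≋x′ x′≋x , F.E-trans d′ e

      E-limit : (s : ℕ → ∣ M ∣) → (∀ k → E k (s k) (s (suc k))) → ∃[ x ] (∀ k → E k (s k) x)
      E-limit s step = proj₁ lim , λ k → proj₁ (t k) , proj₂ (t k) , proj₂ lim k
        where
        next : ∀ k (u : Σ[ w ∈ ∣ M ∣ ] w ≋ s k) → Σ[ v ∈ ∣ M ∣ ] (v ≋ s (suc k) × F.E k v (proj₁ u))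
        next k (u , u≋s) =
          let (v , v≋s , e) = E-sym (step k) in
          let (v′ , v′≋v , e′) = translate e u≋s in
          v′ , ≋-trans v′≋v v≋s , e′
        t : ∀ k → Σ[ u ∈ ∣ M ∣ ] u ≋ s k
        t zero = s 0 , ≋-refl {s 0}
        t (suc k) = let (v , v≋s , _) = next k (t k) in v , v≋s
        lim = F.E-limit (proj₁ ∘ t) λ k → F.E-sym (proj₂ (proj₂ (next k (t k))))

    coimage-filtration : Filtration coimage
    coimage-filtration = record
      { E = E
      ; E-refl = λ {_} {x} {y} x≋y → y , ≋-sym x≋y , F.E-refl M.≈ᴹ-refl
      ; E-sym = E-sym
      ; E-trans = E-trans
      ; E-zero = λ {x} → x , ≋-refl {x} , F.E-zero
      ; E-≤ = λ m≤n (x′ , p , e) → x′ , p , F.E-≤ m≤n e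
      ; E-sep = λ e → F′.E-sep λ m → image-close m (e (proj₁ (uniform m)))
      ; E-+ = λ (x′ , p , e) (y′ , q , d) → x′ M.+ᴹ y′ , ≋-+ p q , F.E-+ e d
      ; E-neg = λ (x′ , p , e) → M.-ᴹ x′ , ≋-neg p , F.E-neg e
      ; E-* = λ r (x′ , p , e) → r M.*ₗ x′ , ≋-* (CommutativeRing.refl R) p , F.E-* r e
      ; E-limit = E-limit
      ; E-dense = proj₁ F.E-dense , λ x n →
          let (k , e) = proj₂ F.E-dense x n in k , _ , ≋-refl {proj₁ F.E-dense k} , e
      }

    image-polishable : Polishable (filtrationPolish F′) (Image f)
    image-polishable = filtrationPolish coimage-filtration
      , record
        { hom = mkHom ⟦ f ⟧ id f.+ᴹ-homo f.*ₗ-homo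
        ; continuous = λ U open-U Ufx →
            let (m , h) = open-U Ufx in proj₁ (uniform m) , λ e → h (image-close m e)
        ; injective = id
        }
      , id , id

------------------------------------------------------------------------
-- Towers and lim¹

record Tower (R : CommutativeRing 0ℓ 0ℓ) : Set₁ where
  field
    A         : ℕ → Mod R
    countable : ∀ n → Countable (Module._≈ᴹ_ (A n))
    p         : ∀ n → Hom (A (suc n)) (A n)

  -- bond k n is the bonding map p^(n,k+n).
  bond : ∀ k n → ∣ A (k + n) ∣ → ∣ A n ∣
  bond zero    n x = x
  bond (suc k) n x = bond k n (⟦ p (k + n) ⟧ x)

module _ {R : CommutativeRing 0ℓ 0ℓ} where

  module _ (M : Mod R) where

    open Module M
    open AbelianGroupProperties +ᴹ-abelianGroup using (⁻¹-∙-comm; inverseʳ-unique)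
    open CommutativeSemigroupProperties
      (CommutativeMonoid.commutativeSemigroup +ᴹ-commutativeMonoid) using (interchange)

    minus-+ : ∀ x y u v → (x +ᴹ y) +ᴹ (-ᴹ (u +ᴹ v)) ≈ᴹ (x +ᴹ (-ᴹ u)) +ᴹ (y +ᴹ (-ᴹ v))
    minus-+ x y u v = ≈ᴹ-trans (+ᴹ-congˡ (≈ᴹ-sym (⁻¹-∙-comm u v)))
      (interchange x y (-ᴹ u) (-ᴹ v))

    minus-* : ∀ r x u → (r *ₗ x) +ᴹ (-ᴹ (r *ₗ u)) ≈ᴹ r *ₗ (x +ᴹ (-ᴹ u))
    minus-* r x u = ≈ᴹ-trans (+ᴹ-congˡ (≈ᴹ-sym neg)) (≈ᴹ-sym (*ₗ-distribˡ r x (-ᴹ u)))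
      where
      neg : r *ₗ (-ᴹ u) ≈ᴹ -ᴹ (r *ₗ u)
      neg = inverseʳ-unique (r *ₗ u) (r *ₗ (-ᴹ u))
        (≈ᴹ-trans (≈ᴹ-sym (*ₗ-distribˡ r u (-ᴹ u)))
          (≈ᴹ-trans (*ₗ-cong (CommutativeRing.refl R) (-ᴹ‿inverseʳ u)) (*ₗ-zeroʳ r)))

  module _ (T : Tower R) where

    open Tower T

    private
      module A n = Module (A n)
      module p n = Hom (p n)

    difference : Hom (∏ A) (∏ A)
    difference = mkHom (λ x n → A._+ᴹ_ n (x n) (A.-ᴹ_ n (⟦ p n ⟧ (x (suc n)))))
      (λ e n → A.+ᴹ-cong n (e n) (A.-ᴹ‿cong n (p.⟦⟧-cong n (e (suc n)))))
      (λ x y n → A.≈ᴹ-trans n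
        (A.+ᴹ-congˡ n (A.-ᴹ‿cong n (p.+ᴹ-homo n (x (suc n)) (y (suc n)))))
        (minus-+ (A n) (x n) (y n) (⟦ p n ⟧ (x (suc n))) (⟦ p n ⟧ (y (suc n)))))
      (λ r x n → A.≈ᴹ-trans n
        (A.+ᴹ-congˡ n (A.-ᴹ‿cong n (p.*ₗ-homo n r (x (suc n)))))
        (minus-* (A n) r (x n) (⟦ p n ⟧ (x (suc n)))))

    lim¹ : PolishCover R
    lim¹ = record
      { cover = filtrationPolish (∏-filtration A countable)
      ; N = Image difference
      ; polishable = image-polishable F F difference λ m → suc m , λ e i i<m →
          A.+ᴹ-cong i (e i (ℕₚ.m<n⇒m<1+n i<m)) (A.-ᴹ‿cong i (p.⟦⟧-cong i (e (suc i) (s≤s i<m))))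
      }
      where
      F = ∏-filtration A countable

------------------------------------------------------------------------
-- Derived towers

module _ {R : CommutativeRing 0ℓ 0ℓ} {O : CountableOrdinals} (F : FundamentalSequences O)
         (T : Tower R) where

  open CountableOrdinals O
  open FundamentalSequences F
  open Tower T

  private
    module A n = Module (A n)
    module p n = Hom (p n)

  -- Derived α n is A^(n)_α, for α zero or a successor; β is α-1 in sucᵈ.  It is
  -- empty for α a limit, in which case A^(n)_α is not defined.
  data Derived : Ord → (n : ℕ) → Pred ∣ A n ∣ 0ℓ where
    zeroᵈ : ∀ {α n x} → IsZero α → Derived α n x
    sucᵈ  : ∀ {α β n x} → β ⋖ α →
            (∀ k → ∃[ y ] (Derived (β [ k ]) (k + n) y × A._≈ᴹ_ n (bond k n y) x)) →
            Derived α n x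

  private
    bond-cong : ∀ k n {x y} → A._≈ᴹ_ (k + n) x y → A._≈ᴹ_ n (bond k n x) (bond k n y)
    bond-cong zero    n e = e
    bond-cong (suc k) n e = bond-cong k n (p.⟦⟧-cong (k + n) e)

    bond-+ : ∀ k n x y → A._≈ᴹ_ n (bond k n (A._+ᴹ_ (k + n) x y))
                                  (A._+ᴹ_ n (bond k n x) (bond k n y))
    bond-+ zero    n x y = A.≈ᴹ-refl n
    bond-+ (suc k) n x y = A.≈ᴹ-trans n (bond-cong k n (p.+ᴹ-homo (k + n) x y))
      (bond-+ k n (⟦ p (k + n) ⟧ x) (⟦ p (k + n) ⟧ y))

    bond-neg : ∀ k n x → A._≈ᴹ_ n (bond k n (A.-ᴹ_ (k + n) x)) (A.-ᴹ_ n (bond k n x))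
    bond-neg zero    n x = A.≈ᴹ-refl n
    bond-neg (suc k) n x = A.≈ᴹ-trans n (bond-cong k n (p.-ᴹ-homo (k + n) x))
      (bond-neg k n (⟦ p (k + n) ⟧ x))

    bond-* : ∀ k n r x → A._≈ᴹ_ n (bond k n (A._*ₗ_ (k + n) r x)) (A._*ₗ_ n r (bond k n x))
    bond-* zero    n r x = A.≈ᴹ-refl n
    bond-* (suc k) n r x = A.≈ᴹ-trans n (bond-cong k n (p.*ₗ-homo (k + n) r x))
      (bond-* k n r (⟦ p (k + n) ⟧ x))

    bond-0 : ∀ k n → A._≈ᴹ_ n (bond k n (A.0ᴹ (k + n))) (A.0ᴹ n)
    bond-0 zero    n = A.≈ᴹ-refl n
    bond-0 (suc k) n = A.≈ᴹ-trans n (bond-cong k n (p.0ᴹ-homo (k + n))) (bond-0 k n)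

    ⋖-unique : ∀ {α β γ} → β ⋖ α → γ ⋖ α → β ≡ γ
    ⋖-unique {α} {β} {γ} (β≺α , β-max) (γ≺α , γ-max) with compare β γ
    ... | tri< β≺γ _ _ = ⊥-elim (β-max γ β≺γ γ≺α)
    ... | tri≈ _ β≡γ _ = β≡γ
    ... | tri> _ _ γ≺β = ⊥-elim (γ-max β γ≺β β≺α)

    D-resp : ∀ {α n x y} → A._≈ᴹ_ n x y → Derived α n x → Derived α n y
    D-resp e (zeroᵈ z) = zeroᵈ z
    D-resp {n = n} e (sucᵈ b f) =
      sucᵈ b λ k → let (y , d , q) = f k in y , d , A.≈ᴹ-trans n q e

    D-+ : ∀ {α n x y} → Derived α n x → Derived α n y → Derived α n (A._+ᴹ_ n x y)
    D-+ (zeroᵈ z) _ = zeroᵈ z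
    D-+ (sucᵈ b f) (zeroᵈ z) = zeroᵈ z
    D-+ {n = n} (sucᵈ b f) (sucᵈ c g) with ⋖-unique b c
    ... | refl = sucᵈ b λ k → add k (f k) (g k)
      where
      add : ∀ k {x y} → ∃[ u ] (Derived _ (k + n) u × A._≈ᴹ_ n (bond k n u) x) →
            ∃[ v ] (Derived _ (k + n) v × A._≈ᴹ_ n (bond k n v) y) →
            ∃[ w ] (Derived _ (k + n) w × A._≈ᴹ_ n (bond k n w) (A._+ᴹ_ n x y))
      add k (u , d , e) (v , d′ , e′) = A._+ᴹ_ (k + n) u v , D-+ d d′
        , A.≈ᴹ-trans n (bond-+ k n u v) (A.+ᴹ-cong n e e′)

    D-neg : ∀ {α n x} → Derived α n x → Derived α n (A.-ᴹ_ n x)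
    D-neg (zeroᵈ z) = zeroᵈ z
    D-neg {n = n} (sucᵈ b f) = sucᵈ b λ k → let (u , d , e) = f k in
      A.-ᴹ_ (k + n) u , D-neg d , A.≈ᴹ-trans n (bond-neg k n u) (A.-ᴹ‿cong n e)

    D-* : ∀ {α n x} r → Derived α n x → Derived α n (A._*ₗ_ n r x)
    D-* r (zeroᵈ z) = zeroᵈ z
    D-* {n = n} r (sucᵈ b f) = sucᵈ b λ k → let (u , d , e) = f k in
      A._*ₗ_ (k + n) r u , D-* r d
      , A.≈ᴹ-trans n (bond-* k n r u) (A.*ₗ-cong n (CommutativeRing.refl R) e)

    C : ℕ → Set
    C n = ∣ A n ∣

    p-subst : ∀ {m n} (e : m ≡ n) (x : C (suc m)) →
              ⟦ p n ⟧ (subst C (cong suc e) x) ≡ subst C e (⟦ p m ⟧ x)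
    p-subst refl x = refl

    bond-p : ∀ k n (y : C (k + suc n)) →
             A._≈ᴹ_ n (bond k n (⟦ p (k + n) ⟧ (subst C (ℕₚ.+-suc k n) y)))
                      (⟦ p n ⟧ (bond k (suc n) y))
    bond-p zero    n y = A.≈ᴹ-refl n
    bond-p (suc k) n y rewrite p-subst (ℕₚ.+-suc k n) y = bond-p k n (⟦ p (k + suc n) ⟧ y)

    bond-bond : ∀ j k n (y : C ((j + k) + n)) →
                A._≈ᴹ_ n (bond k n (bond j (k + n) (subst C (ℕₚ.+-assoc j k n) y)))
                         (bond (j + k) n y)
    bond-bond zero    k n y = A.≈ᴹ-refl n
    bond-bond (suc j) k n y rewrite p-subst (ℕₚ.+-assoc j k n) y =
      bond-bond j k n (⟦ p ((j + k) + n) ⟧ y)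

    D-subst : ∀ {α m n x} (e : m ≡ n) → Derived α m x → Derived α n (subst C e x)
    D-subst refl d = d

    D-p : ∀ {α m x} → Derived α m x → ∀ n (e : m ≡ suc n) →
          Derived α n (⟦ p n ⟧ (subst C e x))
    D-p (zeroᵈ z) n e = zeroᵈ z
    D-p (sucᵈ b f) n refl = sucᵈ b λ k → let (y , d , q) = f k in
      ⟦ p (k + n) ⟧ (subst C (ℕₚ.+-suc k n) y) , D-p d (k + n) (ℕₚ.+-suc k n)
      , A.≈ᴹ-trans n (bond-p k n y) (p.⟦⟧-cong n q)

    D-bond : ∀ {α} j m {x} → Derived α (j + m) x → Derived α m (bond j m x)
    D-bond zero    m d = d
    D-bond (suc j) m d = D-bond j m (D-p d (j + m) refl)

  module _ (em : ExcludedMiddle 0ℓ) where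

    private
      Zero⊎Suc : Ord → Set
      Zero⊎Suc α = IsZero α ⊎ ∃[ β ] β ⋖ α

      suc⇒¬limit : ∀ {α β} → β ⋖ α → ¬ IsLimit α
      suc⇒¬limit b (_ , h) = h _ b

      zero⊎suc : ∀ {α} → ¬ IsLimit α → Zero⊎Suc α
      zero⊎suc {α} ¬lim with em {IsZero α}
      ... | yes z = inj₁ z
      ... | no ¬z with em {∃[ β ] β ⋖ α}
      ...   | yes s = inj₂ s
      ...   | no ¬s = ⊥-elim (¬lim (¬z , λ β b → ¬s (β , b)))

      [-]-zero⊎suc : ∀ α n → Zero⊎Suc (α [ n ])
      [-]-zero⊎suc α n with em {IsLimit α}
      ... | yes lim = inj₂ (successor n lim)
      ... | no ¬lim = subst Zero⊎Suc (sym (constant n ¬lim)) (zero⊎suc ¬lim)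

      [-]-≺ : ∀ {α β} n → β ≺ α → β [ n ] ≺ α
      [-]-≺ {α} {β} n β≺α with em {IsLimit β}
      ... | yes lim = ≺-trans (below n lim) β≺α
      ... | no ¬lim = subst (_≺ α) (sym (constant n ¬lim)) β≺α

      ≺-[+] : ∀ {α δ} m k → IsLimit α → δ ≺ α [ m ] → δ ≺ α [ k + m ]
      ≺-[+] m zero    lim h = h
      ≺-[+] m (suc k) lim h = ≺-trans (≺-[+] m k lim h) (increasing (k + m) lim)

      overtake : ∀ {β δ} k → δ ≺ β → ∃[ j ] δ [ k ] ≺ β [ j + k ]
      overtake {β} {δ} k δ≺β with em {IsLimit β}
      ... | no ¬lim = 0 , subst (δ [ k ] ≺_) (sym (constant k ¬lim)) ([-]-≺ k δ≺β)
      ... | yes lim = let (m , h) = cofinal δ lim δ≺β in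
        m , subst (λ i → δ [ k ] ≺ β [ i ]) (ℕₚ.+-comm k m) (≺-[+] m k lim ([-]-≺ k h))

      D-0 : ∀ {α} → Acc _≺_ α → Zero⊎Suc α → ∀ n → Derived α n (A.0ᴹ n)
      D-0 _         (inj₁ z)       n = zeroᵈ z
      D-0 (acc rec) (inj₂ (β , b)) n = sucᵈ b λ k →
        A.0ᴹ (k + n) , D-0 (rec ([-]-≺ k (proj₁ b))) ([-]-zero⊎suc β k) (k + n) , bond-0 k n

      D-antitone : ∀ {α γ n x} → γ ≺ α → Zero⊎Suc γ → Derived α n x → Derived γ n x
      D-antitone _ (inj₁ z) _ = zeroᵈ z
      D-antitone γ≺α (inj₂ _) (zeroᵈ z) = ⊥-elim (z _ γ≺α)
      D-antitone {α} {γ} {n} {x} γ≺α (inj₂ (δ , c)) (sucᵈ {β = β} b f) = sucᵈ c λ k → go k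
        where
        δ≺β : δ ≺ β
        δ≺β with compare γ β
        ... | tri< γ≺β _ _ = ≺-trans (proj₁ c) γ≺β
        ... | tri≈ _ refl _ = proj₁ c
        ... | tri> _ _ β≺γ = ⊥-elim (proj₂ b γ β≺γ γ≺α)
        go : ∀ k → ∃[ y ] (Derived (δ [ k ]) (k + n) y × A._≈ᴹ_ n (bond k n y) x)
        go k with overtake k δ≺β
        ... | j , lt with f (j + k)
        ...   | y , d , q = bond j (k + n) (subst C (ℕₚ.+-assoc j k n) y)
          , D-bond j (k + n) (D-subst (ℕₚ.+-assoc j k n) (D-antitone lt ([-]-zero⊎suc δ k) d))
          , A.≈ᴹ-trans n (bond-bond j k n y) q

    derivedSubmodule : ∀ α n → Submodule (A n)
    derivedSubmodule α n = record
      { Mem = Derived (α [ n ]) n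
      ; resp = D-resp
      ; 0-mem = D-0 (wellFounded (α [ n ])) ([-]-zero⊎suc α n) n
      ; +-mem = D-+
      ; neg-mem = D-neg
      ; *ₗ-mem = λ r d → D-* r d
      }

    private
      p-mem : ∀ α n {x} → Derived (α [ suc n ]) (suc n) x → Derived (α [ n ]) n (⟦ p n ⟧ x)
      p-mem α n {x} d with em {IsLimit α}
      ... | yes lim = D-antitone (increasing n lim) ([-]-zero⊎suc α n) (D-p d n refl)
      ... | no ¬lim = subst (λ β → Derived β n (⟦ p n ⟧ x))
        (trans (constant (suc n) ¬lim) (sym (constant n ¬lim))) (D-p d n refl)

      enumeration : ∀ α n → Countable (Module._≈ᴹ_ (toModule (derivedSubmodule α n)))
      enumeration α n = e , λ (x , d) → let (k , q) = proj₂ (countable n) x in k , hits k d q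
        where
        open Submodule (derivedSubmodule α n)
        e : ℕ → ∣ toModule (derivedSubmodule α n) ∣
        e k with em {Mem (proj₁ (countable n) k)}
        ... | yes d = proj₁ (countable n) k , d
        ... | no _  = A.0ᴹ n , 0-mem
        hits : ∀ k {x} → Mem x → A._≈ᴹ_ n (proj₁ (countable n) k) x → A._≈ᴹ_ n (proj₁ (e k)) x
        hits k d q with em {Mem (proj₁ (countable n) k)}
        ... | yes _ = q
        ... | no ¬d = ⊥-elim (¬d (resp (A.≈ᴹ-sym n q) d))

    -- The α-th derived tower.
    derived : Ord → Tower R
    derived α = record
      { A = λ n → toModule (derivedSubmodule α n)
      ; countable = enumeration α
      ; p = λ n → mkHom (λ (x , d) → ⟦ p n ⟧ x , p-mem α n d)
          (p.⟦⟧-cong n) (λ (x , _) (y , _) → p.+ᴹ-homo n x y) (λ r (x , _) → p.*ₗ-homo n r x)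
      }

    inclusion : ∀ α → Hom (∏ (Tower.A (derived α))) (∏ A)
    inclusion α = mkHom (λ x n → proj₁ (x n))
      (λ e n → e n) (λ x y n → A.≈ᴹ-refl n) (λ r x n → A.≈ᴹ-refl n)

    -- On representatives, the homomorphism lim¹ A_α → lim¹ A induced by the
    -- inclusion A_α → A is `inclusion α`.

    lim¹-inclusion-injective : Ord → Set
    lim¹-inclusion-injective α =
      ∀ x y → ⟦ inclusion α ⟧ x ∼ ⟦ inclusion α ⟧ y → x ∼α y
      where
      open PolishCover (lim¹ T) using (_∼_)
      open PolishCover (lim¹ (derived α)) using () renaming (_∼_ to _∼α_)

    lim¹-inclusion-image : Ord → Pred ∣ ∏ A ∣ 0ℓ
    lim¹-inclusion-image α y = ∃[ x ] ⟦ inclusion α ⟧ x ∼ y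
      where open PolishCover (lim¹ T) using (_∼_)

{-# OPTIONS --safe #-}

-- If z n - p (z (suc n)) lies in A_α for all n then so does z n: for α = β + 1
-- write z n as a partial sum, which lifts to A_β, plus p^k (z (k + n)), and use
-- induction.  Hence lim¹ A_α → lim¹ A is injective, and at a limit α the diagonal
-- of solutions z^n of y = x^n + δ z^n with x^n in A_{α_n} shows that
-- lim¹ A_α is the intersection of the lim¹ A_β.
--
-- At β + 1, with B = A_β, C = A_{β+1} and δ z = (z n - p (z (suc n)))_n, the
-- module ∏ C + δ (∏ A) consists of the points of ∏ B + δ (∏ A) that lie, for each
-- k, in the closure of a translate of δ {z | z = 0 below k} by an element of
-- δ (∏ A).  Countably many translates suffice, which gives the Π⁰₃ bound.
-- Conversely let H be a Π⁰₃ subgroup containing δ (∏ A).  Each Σ⁰₂ set containing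
-- H contains, by Baire's theorem in δ (∏ A), the closure of some translate as above
-- and hence an open subset of ∏ C + δ (∏ A), anywhere in that group.  So H is
-- comeagre in ∏ C + δ (∏ A), and a comeagre subgroup is everything.

module Submission where

open import Defs
open import Level using (0ℓ)
open import Algebra.Bundles using (AbelianGroup; CommutativeRing)
open import Algebra.Module.Bundles using (Module)
open import Algebra.Module.Construct.DirectProduct using (⟨module⟩)
import Algebra.Properties.AbelianGroup as AbelianGroupProperties
import Algebra.Properties.CommutativeSemigroup as CommutativeSemigroupProperties
import Algebra.Solver.CommutativeMonoid.Normal as CommutativeMonoidNormal
open import Axiom.ExcludedMiddle using (ExcludedMiddle)
open import Data.Empty using (⊥-elim)
open import Data.Fin.Base using (Fin)
open import Data.Fin.Patterns using (0F; 1F; 2F; 3F)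
open import Data.Nat.Base using (ℕ; zero; suc; _+_; _≤_; _<_; _⊔_; z≤n; s≤s)
import Data.Nat.Properties as ℕₚ
open import Data.Product using (∃-syntax; _×_; _,_; proj₁; proj₂)
open import Data.Sum.Base using (_⊎_; inj₁; inj₂)
open import Data.Vec.Base using (_∷_; [])
open import Function.Base using (_∘_)
open import Induction.WellFounded using (Acc; acc)
open import Relation.Binary.Definitions using (tri<; tri≈; tri>)
open import Relation.Binary.PropositionalEquality using (_≡_; refl; sym; trans; subst; cong)
import Relation.Binary.Reasoning.Setoid as SetoidReasoning
open import Relation.Nullary using (¬_; yes; no)
open import Relation.Nullary.Decidable using (decidable-stable)
open import Relation.Unary using (Pred; _⊆_; _≐_; _⊢_)

-- Deciding identities in abelian groups.

infixl 6 _⊕_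
infix 8 ⊖_

data GroupExpr (n : ℕ) : Set where
  var : Fin n → GroupExpr n
  nil : GroupExpr n
  _⊕_ : GroupExpr n → GroupExpr n → GroupExpr n
  ⊖_  : GroupExpr n → GroupExpr n

module _ (G : AbelianGroup 0ℓ 0ℓ) where

  open AbelianGroup G renaming (refl to ≈-refl; sym to ≈-sym; trans to ≈-trans)
  open AbelianGroupProperties G using (∙-cancelʳ)
  open CommutativeSemigroupProperties
    (AbelianGroup.commutativeSemigroup G) using (interchange)
  private module CM = CommutativeMonoidNormal commutativeMonoid
  open CM using (Env) renaming (var to varᶜ; id to idᶜ; _⊕_ to _⊕ᶜ_; ⟦_⟧ to ⟦_⟧ᶜ)

  private
    eval : ∀ {n} → GroupExpr n → Env n → Carrier
    eval (var x) ρ = ⟦ varᶜ x ⟧ᶜ ρ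
    eval nil ρ = ε
    eval (e ⊕ f) ρ = eval e ρ ∙ eval f ρ
    eval (⊖ e) ρ = eval e ρ ⁻¹

    pos neg : ∀ {n} → GroupExpr n → CM.Expr n
    pos (var x) = varᶜ x
    pos nil     = idᶜ
    pos (e ⊕ f) = pos e ⊕ᶜ pos f
    pos (⊖ e)   = neg e
    neg (var x) = idᶜ
    neg nil     = idᶜ
    neg (e ⊕ f) = neg e ⊕ᶜ neg f
    neg (⊖ e)   = pos e

    split : ∀ {n} (e : GroupExpr n) ρ → eval e ρ ∙ ⟦ neg e ⟧ᶜ ρ ≈ ⟦ pos e ⟧ᶜ ρ
    split (var x) ρ = identityʳ _
    split nil     ρ = identityʳ _
    split (e ⊕ f) ρ = ≈-trans (interchange _ _ _ _) (∙-cong (split e ρ) (split f ρ))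
    split (⊖ e)   ρ = begin
      eval e ρ ⁻¹ ∙ ⟦ pos e ⟧ᶜ ρ             ≈⟨ ∙-congˡ (split e ρ) ⟨
      eval e ρ ⁻¹ ∙ (eval e ρ ∙ ⟦ neg e ⟧ᶜ ρ) ≈⟨ assoc _ _ _ ⟨
      (eval e ρ ⁻¹ ∙ eval e ρ) ∙ ⟦ neg e ⟧ᶜ ρ ≈⟨ ∙-congʳ (inverseˡ _) ⟩
      ε ∙ ⟦ neg e ⟧ᶜ ρ                       ≈⟨ identityˡ _ ⟩
      ⟦ neg e ⟧ᶜ ρ                           ∎
      where open SetoidReasoning setoid

  -- By `split` an expression is its positive part minus its negative part, so e = f becomes an
  -- identity without inverses, which normal forms in commutative monoids decide.
  solve-group : ∀ {n} (e f : GroupExpr n) →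
          CM.normalise (pos e ⊕ᶜ neg f) ≡ CM.normalise (pos f ⊕ᶜ neg e) →
          ∀ ρ → eval e ρ ≈ eval f ρ
  solve-group e f eq ρ = ∙-cancelʳ (⟦ neg e ⟧ᶜ ρ ∙ ⟦ neg f ⟧ᶜ ρ) _ _ (begin
    eval e ρ ∙ (⟦ neg e ⟧ᶜ ρ ∙ ⟦ neg f ⟧ᶜ ρ)   ≈⟨ assoc _ _ _ ⟨
    (eval e ρ ∙ ⟦ neg e ⟧ᶜ ρ) ∙ ⟦ neg f ⟧ᶜ ρ   ≈⟨ ∙-congʳ (split e ρ) ⟩
    ⟦ pos e ⊕ᶜ neg f ⟧ᶜ ρ                      ≈⟨ CM.correct (pos e ⊕ᶜ neg f) ρ ⟨
    CM.⟦ CM.normalise (pos e ⊕ᶜ neg f) ⟧⇓ ρ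
      ≡⟨ cong (λ v → CM.⟦ v ⟧⇓ ρ) eq ⟩
    CM.⟦ CM.normalise (pos f ⊕ᶜ neg e) ⟧⇓ ρ   ≈⟨ CM.correct (pos f ⊕ᶜ neg e) ρ ⟩
    ⟦ pos f ⊕ᶜ neg e ⟧ᶜ ρ                      ≈⟨ ∙-congʳ (split f ρ) ⟨
    (eval f ρ ∙ ⟦ neg f ⟧ᶜ ρ) ∙ ⟦ neg e ⟧ᶜ ρ   ≈⟨ assoc _ _ _ ⟩
    eval f ρ ∙ (⟦ neg f ⟧ᶜ ρ ∙ ⟦ neg e ⟧ᶜ ρ)   ≈⟨ ∙-congˡ (comm _ _) ⟩
    eval f ρ ∙ (⟦ neg e ⟧ᶜ ρ ∙ ⟦ neg f ⟧ᶜ ρ)   ∎)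
    where open SetoidReasoning setoid

-- Baire category and the smallest Π⁰₃ submodule.

module _ {R : CommutativeRing 0ℓ 0ℓ} where

  module _ {M : Mod R} (F : Filtration M) where

    open Filtration F

    DenseInterior : Pred ∣ M ∣ 0ℓ → Set
    DenseInterior D =
      ∀ x k → ∃[ x′ ] ∃[ k′ ] (E k x x′ × (∀ {y} → E k′ x′ y → D y))

    -- The centres of nested balls, each inside the next `D n`, converge; balls of an ultrametric
    -- are closed, so the limit stays in all of them.
    baire : (D : ℕ → Pred ∣ M ∣ 0ℓ) → (∀ n → DenseInterior (D n)) →
            ∀ x k → ∃[ y ] (E k x y × (∀ n → D n y))
    baire D dense x₀ k₀ = y , in-ball 0 , λ n → proj₂ (proj₂ (proj₂ (next n)))
        (E-≤ (ℕₚ.≤-trans (ℕₚ.m≤m⊔n _ _) (ℕₚ.n≤1+n _)) (in-ball (suc n)))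
      where
      stage : ℕ → ∣ M ∣ × ℕ
      next : ∀ n → _
      next n = dense n (proj₁ (stage n)) (proj₂ (stage n))
      stage zero = x₀ , k₀
      -- The new ball lies in the one provided by `dense` and in the current one; the `suc` forces
      -- `n ≤ k n`, which `E-limit` needs.
      stage (suc n) = proj₁ (next n) , suc (proj₁ (proj₂ (next n)) ⊔ proj₂ (stage n))
      x : ℕ → ∣ M ∣
      x n = proj₁ (stage n)
      k : ℕ → ℕ
      k n = proj₂ (stage n)
      k-inc : ∀ n → k n < k (suc n)
      k-inc n = s≤s (ℕₚ.m≤n⊔m _ _)
      n≤k : ∀ n → n ≤ k n
      n≤k zero = z≤n
      n≤k (suc n) = ℕₚ.≤-trans (s≤s (n≤k n)) (k-inc n)
      step : ∀ n → E (k n) (x n) (x (suc n))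
      step n = proj₁ (proj₂ (proj₂ (next n)))
      lim = E-limit x λ n → E-≤ (n≤k n) (step n)
      y = proj₁ lim
      k-mono : ∀ j n → k n ≤ k (j + n)
      k-mono zero    n = ℕₚ.≤-refl
      k-mono (suc j) n = ℕₚ.≤-trans (k-mono j n) (ℕₚ.<⇒≤ (k-inc (j + n)))
      steps : ∀ j n → E (k n) (x n) (x (j + n))
      steps zero    n = E-refl (Module.≈ᴹ-refl M)
      steps (suc j) n = E-trans (steps j n) (E-≤ (k-mono j n) (step (j + n)))
      in-ball : ∀ n → E (k n) (x n) y
      -- At stage j the limit is known only up to `E j`, so precision `k n` is reached by going on
      -- to stage `k n + n`.
      in-ball n = E-trans (steps (k n) n) (E-≤ (ℕₚ.m≤m+n (k n) n) (proj₂ lim (k n + n)))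

  module _ (em : ExcludedMiddle 0ℓ) {N G : Mod R} (FN : Filtration N) (FG : Filtration G)
           (i : Hom N G) where

    private
      module FN = Filtration FN
      module FG = Filtration FG

    -- If Ĝ has the topology of FG and N that of FN, this is Solecki's
    -- description of s₁: for every basic neighbourhood V of 0 in N, y lies in
    -- the closure of some translate a + V.
    Approximable : Pred ∣ G ∣ 0ℓ
    Approximable y = ∀ k → ∃[ a ] (∀ m → ∃[ u ] (FN.E k a u × FG.E m y (⟦ i ⟧ u)))

    -- Only countably many translates of V are needed.
    Approximable-Π⁰₃ : Π⁰₃ FG.FOpen Approximable
    Approximable-Π⁰₃ = (λ k y → ∃[ a ] Near k a y)
      , (λ k → (λ j → Near k (t j)) , (λ j → closed k (t j))
             , (λ {y} (a , h) → let (j , e) = proj₂ FN.E-dense a k in j , λ m →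
                 let (u , e′ , d) = h m in u , FN.E-trans e e′ , d)
             , λ (j , h) → t j , h)
      , (λ h k → h k) , (λ h k → h k)
      where
      t = proj₁ FN.E-dense
      Near : ℕ → ∣ N ∣ → Pred ∣ G ∣ 0ℓ
      Near k a y = ∀ m → ∃[ u ] (FN.E k a u × FG.E m y (⟦ i ⟧ u))
      closed : ∀ k a → Closed FG.FOpen (Near k a)
      closed k a {y} ¬near with em {∃[ m ] ¬ (∃[ u ] (FN.E k a u × FG.E m y (⟦ i ⟧ u)))}
      ... | yes (m , ¬u) = m , λ e near → let (u , d , e′) = near m in
        ¬u (u , d , FG.E-trans e e′)
      ... | no none = ⊥-elim (¬near λ m → decidable-stable em λ ¬u → none (m , ¬u))

    -- Under `approximate`, every small ball of N near a has a counterpart: a ball of L near l whose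
    -- image lies in the closure of its image in G.
    module _ {L : Mod R} (FL : Filtration L) (j : Hom L G)
      (i-continuous : ∀ x m → ∃[ n ] (∀ {y} → FN.E n x y → FG.E m (⟦ i ⟧ x) (⟦ i ⟧ y)))
      (approximate : ∀ l k → ∃[ a ] (∀ k₁ b → k ≤ k₁ → FN.E k a b →
        ∃[ l′ ] (Filtration.E FL k l l′ × (∀ {l″} → Filtration.E FL k₁ l′ l″ → ∀ m →
          ∃[ u ] (FN.E k₁ b u × FG.E m (⟦ j ⟧ l″) (⟦ i ⟧ u))))))
      where

      private
        module L = Module L
        module G = Module G
        module FL = Filtration FL
        module j = Hom j

      -- By Baire's theorem in N one of the closed sets making up S contains the
      -- image of a ball of N, hence also its closure, and `approximate` places a
      -- ball of L into that closure.
      Σ⁰₂-denseInterior : ∀ {S} → Σ⁰₂ FG.FOpen S → Image i ⊆ S →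
                          DenseInterior FL (⟦ j ⟧ ⊢ S)
      Σ⁰₂-denseInterior {S} (C , closed , S⊆ , S⊇) i⊆S l k with approximate l k
      ... | a , approx with em {∃[ m ] ∃[ k₁ ] ∃[ b ] (k ≤ k₁ × FN.E k a b ×
                                (∀ u → FN.E k₁ b u → C m (⟦ i ⟧ u)))}
      ...   | yes (m , k₁ , b , k≤k₁ , e , inside) =
        let (l′ , d , near) = approx k₁ b k≤k₁ e in
        l′ , k₁ , d , λ {l″} e′ → S⊇ (m , decidable-stable em λ ¬C →
          let (n , out) = closed m ¬C
              (u , e″ , f) = near e′ n
          in out f (inside u e″))
      ...   | no none =
        -- No `C m` contains the image of a ball inside the k-ball of a, so some u in that ball
        -- avoids them all, although its image lies in S.
        let (u , e , out) = baire FN (λ m u → FN.E k a u → ¬ C m (⟦ i ⟧ u)) avoid a k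
            (m , c) = S⊆ (i⊆S (u , G.≈ᴹ-refl))
        in ⊥-elim (out m e c)
        where
        avoid : ∀ m → DenseInterior FN (λ u → FN.E k a u → ¬ C m (⟦ i ⟧ u))
        avoid m x n with em {FN.E k a x}
        -- Outside the k-ball of a the condition is vacuous, and the complement of that ball is
        -- open.
        ... | no ¬e = x , k , FN.E-refl (Module.≈ᴹ-refl N)
          , λ d e → ⊥-elim (¬e (FN.E-trans e (FN.E-sym d)))
        ... | yes e with em {∃[ u ] (FN.E (n ⊔ k) x u × ¬ C m (⟦ i ⟧ u))}
        ...   | no ¬u = ⊥-elim (none (m , n ⊔ k , x , ℕₚ.m≤n⊔m n k , e , λ u d →
          decidable-stable em λ ¬C → ¬u (u , d , ¬C)))
        ...   | yes (u , d , ¬C) =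
          let (m′ , out) = closed m ¬C
              (n′ , cts) = i-continuous u m′
          in u , n′ , FN.E-≤ (ℕₚ.m≤m⊔n n k) d , λ d′ _ → out (cts d′)

      private
        reflect : ∀ {n l x y} → FL.E n (l L.+ᴹ L.-ᴹ x) y → FL.E n x (l L.+ᴹ L.-ᴹ y)
        reflect {n} {l} {x} {y} e = FL.E-trans
          (FL.E-refl (solve-group L.+ᴹ-abelianGroup (var 0F) (var 1F ⊕ ⊖ (var 1F ⊕ ⊖ var 0F)) refl (x ∷ l ∷ [])))
          (FL.E-+ (FL.E-refl L.≈ᴹ-refl) (FL.E-neg e))
      -- A comeagre subgroup is everything: l is the sum of two elements of H.
      Image⊆Π⁰₃ : ∀ {H} → Π⁰₃ FG.FOpen H →
                  (∀ {x y} → x G.≈ᴹ y → H x → H y) → (∀ {x y} → H x → H y → H (x G.+ᴹ y)) →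
                  Image i ⊆ H → Image j ⊆ H
      Image⊆Π⁰₃ {H} (S , Σ₂ , H⊆ , H⊇) H-resp H-+ i⊆H (l , jl≈y) =
        H-resp (G.≈ᴹ-trans (G.≈ᴹ-sym (j.+ᴹ-homo x (l L.+ᴹ L.-ᴹ x))) (G.≈ᴹ-trans
            (j.⟦⟧-cong (solve-group L.+ᴹ-abelianGroup (var 0F ⊕ (var 1F ⊕ ⊖ var 0F)) (var 1F) refl (x ∷ l ∷ []))) jl≈y))
          (H-+ (H⊇ λ n → proj₁ (proj₂ (proj₂ generic) n))
               (H⊇ λ n → proj₂ (proj₂ (proj₂ generic) n)))
        where
        dense : ∀ n → DenseInterior FL (⟦ j ⟧ ⊢ S n)
        dense n = Σ⁰₂-denseInterior (Σ₂ n) λ h → H⊆ (i⊆H h) n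
        both : ∀ n → DenseInterior FL (λ x → S n (⟦ j ⟧ x) × S n (⟦ j ⟧ (l L.+ᴹ L.-ᴹ x)))
        -- First shrink around x into the n-th set, then shrink the reflected ball around `l - x₁`
        -- in the same way, and reflect the new centre back.
        both n x k =
          let (x₁ , k₁ , e₁ , in₁) = dense n x k
              (x₂ , k₂ , e₂ , in₂) = dense n (l L.+ᴹ L.-ᴹ x₁) (k ⊔ k₁)
              e = reflect e₂
          in l L.+ᴹ L.-ᴹ x₂ , k₁ ⊔ k₂
           , FL.E-trans e₁ (FL.E-≤ (ℕₚ.m≤m⊔n k k₁) e)
           , λ d → in₁ (FL.E-trans (FL.E-≤ (ℕₚ.m≤n⊔m k k₁) e) (FL.E-≤ (ℕₚ.m≤m⊔n k₁ k₂) d))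
                 , in₂ (reflect (FL.E-≤ (ℕₚ.m≤n⊔m k₁ k₂) d))
        generic = baire FL _ both l 0
        x = proj₁ generic

  -- Truncations and solving δ z = x from the top down.

  module _ (M : Mod R) where

    open Module M

    minus-cong : ∀ {x x′ y y′} → x ≈ᴹ x′ → y ≈ᴹ y′ → x +ᴹ -ᴹ y ≈ᴹ x′ +ᴹ -ᴹ y′
    minus-cong e f = +ᴹ-cong e (-ᴹ‿cong f)

    Submodule-minus : (S : Submodule M) → let open Submodule S in
                      ∀ {x y} → Mem x → Mem y → Mem (x +ᴹ -ᴹ y)
    Submodule-minus S p q = +-mem p (neg-mem q)
      where open Submodule S

  truncate : (A : ℕ → Mod R) → ℕ → ∣ ∏ A ∣ → ∣ ∏ A ∣
  truncate A zero    x i       = Module.0ᴹ (A i)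
  truncate A (suc k) x zero    = x 0
  truncate A (suc k) x (suc i) = truncate (A ∘ suc) k (x ∘ suc) i

  truncate-< : ∀ A {k i} x → i < k → truncate A k x i ≡ x i
  truncate-< A {suc k} {zero}  x _         = refl
  truncate-< A {suc k} {suc i} x (s≤s i<k) = truncate-< (A ∘ suc) (x ∘ suc) i<k

  truncate-≥ : ∀ A {k i} x → k ≤ i → truncate A k x i ≡ Module.0ᴹ (A i)
  truncate-≥ A {zero}          x _         = refl
  truncate-≥ A {suc k} {suc i} x (s≤s k≤i) = truncate-≥ (A ∘ suc) (x ∘ suc) k≤i

  -- The solution z of δ z = x below M with z M = v, extended by 0 above M. It is computed downwards
  -- by z i = x i + p (z (i + 1)); the recursion shifts the tower.
  backSolve : (A : ℕ → Mod R) (p : ∀ n → Hom (A (suc n)) (A n)) →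
              ∣ ∏ A ∣ → ∀ M → ∣ A M ∣ → ∣ ∏ A ∣
  backSolve A p x zero    v zero    = v
  backSolve A p x zero    v (suc i) = Module.0ᴹ (A (suc i))
  backSolve A p x (suc M) v zero    = Module._+ᴹ_ (A 0) (x 0)
    (⟦ p 0 ⟧ (backSolve (A ∘ suc) (p ∘ suc) (x ∘ suc) M v 0))
  backSolve A p x (suc M) v (suc i) = backSolve (A ∘ suc) (p ∘ suc) (x ∘ suc) M v i

  backSolve-end : ∀ (A : ℕ → Mod R) p x M v → backSolve A p x M v M ≡ v
  backSolve-end A p x zero    v = refl
  backSolve-end A p x (suc M) v = backSolve-end (A ∘ suc) (p ∘ suc) (x ∘ suc) M v

  backSolve-step : ∀ (A : ℕ → Mod R) p x M v {i} → i < M → let open Module (A i) in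
    backSolve A p x M v i +ᴹ -ᴹ ⟦ p i ⟧ (backSolve A p x M v (suc i)) ≈ᴹ x i
  backSolve-step A p x (suc M) v {zero} _ =
    solve-group (Module.+ᴹ-abelianGroup (A 0)) ((var 0F ⊕ var 1F) ⊕ ⊖ var 1F) (var 0F) refl
      (x 0 ∷ ⟦ p 0 ⟧ (backSolve (A ∘ suc) (p ∘ suc) (x ∘ suc) M v 0) ∷ [])
  backSolve-step A p x (suc M) v {suc i} (s≤s i<M) =
    backSolve-step (A ∘ suc) (p ∘ suc) (x ∘ suc) M v i<M

  backSolve-≥ : ∀ (A : ℕ → Mod R) p x {M i} → M ≤ i → let open Module (A i) in
                backSolve A p x M (Module.0ᴹ (A M)) i ≈ᴹ 0ᴹ
  backSolve-≥ A p x {zero}  {zero}  _         = Module.≈ᴹ-refl (A 0)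
  backSolve-≥ A p x {zero}  {suc i} _         = Module.≈ᴹ-refl (A (suc i))
  backSolve-≥ A p x {suc M} {suc i} (s≤s M≤i) =
    backSolve-≥ (A ∘ suc) (p ∘ suc) (x ∘ suc) M≤i

  backSolve-mem : ∀ (A : ℕ → Mod R) p (S : ∀ n → Submodule (A n)) → let module S n = Submodule (S n) in
    (∀ n {x} → S.Mem (suc n) x → S.Mem n (⟦ p n ⟧ x)) →
    ∀ {x} → (∀ i → S.Mem i (x i)) → ∀ M {v} → S.Mem M v → ∀ i → S.Mem i (backSolve A p x M v i)
  backSolve-mem A p S p-mem x∈ zero    v∈ zero    = v∈
  backSolve-mem A p S p-mem x∈ zero    v∈ (suc i) = Submodule.0-mem (S (suc i))
  backSolve-mem A p S p-mem x∈ (suc M) v∈ zero    = Submodule.+-mem (S 0) (x∈ 0) (p-mem 0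
    (backSolve-mem (A ∘ suc) (p ∘ suc) (S ∘ suc) (p-mem ∘ suc) (x∈ ∘ suc) M v∈ 0))
  backSolve-mem A p S p-mem x∈ (suc M) v∈ (suc i) =
    backSolve-mem (A ∘ suc) (p ∘ suc) (S ∘ suc) (p-mem ∘ suc) (x∈ ∘ suc) M v∈ i

  module _ (T : Tower R) where

    open Tower T

    private
      module A n = Module (A n)
      module p n = Hom (p n)

    δ : ∣ ∏ A ∣ → ∣ ∏ A ∣
    δ = ⟦ difference T ⟧

    module δ = Hom (difference T)

    δ-minus : ∀ x y n → A._≈ᴹ_ n (δ (λ i → A._+ᴹ_ i (x i) (A.-ᴹ_ i (y i))) n)
                                 (A._+ᴹ_ n (δ x n) (A.-ᴹ_ n (δ y n)))
    δ-minus x y n = A.≈ᴹ-trans n (δ.+ᴹ-homo x (λ i → A.-ᴹ_ i (y i)) n)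
      (A.+ᴹ-congˡ n (δ.-ᴹ-homo y n))

    δ≈0⇒≈ : ∀ {n} x → A._≈ᴹ_ n (δ x n) (A.0ᴹ n) → A._≈ᴹ_ n (x n) (⟦ p n ⟧ (x (suc n)))
    δ≈0⇒≈ {n} x = x∙y⁻¹≈ε⇒x≈y (x n) (⟦ p n ⟧ (x (suc n)))
      where open AbelianGroupProperties (A.+ᴹ-abelianGroup n) using (x∙y⁻¹≈ε⇒x≈y)

    truncated-preimage : ∣ ∏ A ∣ → ℕ → ∣ ∏ A ∣
    truncated-preimage x k = backSolve A p x k (A.0ᴹ k)

    -- Finitely supported sequences are coboundaries: with the value 0 from k on, the solution below
    -- k solves the equation everywhere. This makes δ (∏ A) dense in ∏ A.
    δ-truncated-preimage : ∀ x k i →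
      A._≈ᴹ_ i (δ (truncated-preimage x k) i) (truncate A k x i)
    δ-truncated-preimage x k i with ℕₚ.<-≤-connex i k
    ... | inj₁ i<k rewrite truncate-< A x i<k = backSolve-step A p x k _ i<k
    ... | inj₂ k≤i rewrite truncate-≥ A x k≤i = A.≈ᴹ-trans i
      (minus-cong (A i) (backSolve-≥ A p x k≤i)
        (A.≈ᴹ-trans i (p.⟦⟧-cong i (backSolve-≥ A p x (ℕₚ.m≤n⇒m≤1+n k≤i))) (p.0ᴹ-homo i)))
      (A.-ᴹ‿inverseʳ i (A.0ᴹ i))

    bondHom : ∀ k n → Hom (A (k + n)) (A n)
    bondHom k n = mkHom (bond k n) (bond-cong k) (bond-+ k) (bond-* k)
      where
      bond-cong : ∀ k {x y} → A._≈ᴹ_ (k + n) x y → A._≈ᴹ_ n (bond k n x) (bond k n y)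
      bond-cong zero    e = e
      bond-cong (suc k) e = bond-cong k (p.⟦⟧-cong (k + n) e)
      bond-+ : ∀ k x y → A._≈ᴹ_ n (bond k n (A._+ᴹ_ (k + n) x y))
                                  (A._+ᴹ_ n (bond k n x) (bond k n y))
      bond-+ zero    x y = A.≈ᴹ-refl n
      bond-+ (suc k) x y = A.≈ᴹ-trans n (bond-cong k (p.+ᴹ-homo (k + n) x y)) (bond-+ k _ _)
      bond-* : ∀ k r x → A._≈ᴹ_ n (bond k n (A._*ₗ_ (k + n) r x)) (A._*ₗ_ n r (bond k n x))
      bond-* zero    r x = A.≈ᴹ-refl n
      bond-* (suc k) r x = A.≈ᴹ-trans n (bond-cong k (p.*ₗ-homo (k + n) r x)) (bond-* k r _)

    private module bond k n = Hom (bondHom k n)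

    δ≈0⇒bond : ∀ x k n → (∀ i → i < k + n → A._≈ᴹ_ i (δ x i) (A.0ᴹ i)) →
               A._≈ᴹ_ n (x n) (bond k n (x (k + n)))
    δ≈0⇒bond x zero    n h = A.≈ᴹ-refl n
    δ≈0⇒bond x (suc k) n h = A.≈ᴹ-trans n (δ≈0⇒bond x k n λ i i< → h i (ℕₚ.m<n⇒m<1+n i<))
      (bond.⟦⟧-cong k n (δ≈0⇒≈ x (h (k + n) (ℕₚ.n<1+n _))))

    δ-cancel : ∀ x y {i} → A._≈ᴹ_ i (δ x i) (δ y i) → A._≈ᴹ_ (suc i) (x (suc i)) (y (suc i)) →
               A._≈ᴹ_ i (x i) (y i)
    δ-cancel x y {i} h e = ∙-cancelʳ _ _ _ (A.≈ᴹ-trans i h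
      (A.+ᴹ-congˡ i (A.-ᴹ‿cong i (p.⟦⟧-cong i (A.≈ᴹ-sym (suc i) e)))))
      where open AbelianGroupProperties (A.+ᴹ-abelianGroup i) using (∙-cancelʳ)

    -- The equation at i determines x i from x (i + 1), so agreement at k propagates downwards.
    δ-unique : ∀ x y k → (∀ i → i < k → A._≈ᴹ_ i (δ x i) (δ y i)) →
               A._≈ᴹ_ k (x k) (y k) → ∀ i → i < k → A._≈ᴹ_ i (x i) (y i)
    δ-unique x y (suc k) h e i i<1+k with ℕₚ.m≤n⇒m<n∨m≡n (ℕₚ.≤-pred i<1+k)
    ... | inj₂ refl = δ-cancel x y (h i i<1+k) e
    ... | inj₁ i<k = δ-unique x y k (λ m m<k → h m (ℕₚ.m<n⇒m<1+n m<k))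
      (δ-cancel x y (h k (ℕₚ.n<1+n k)) e) i i<k

  -- Images of homomorphisms as modules with a Polish cover.

  module ImageCover {M M′ N : Mod R}
    (F : Filtration M) (F′ : Filtration M′) (FN : Filtration N) (f : Hom M M′)
    (f-uniform : ∀ m → ∃[ n ] (∀ {x y} →
      Filtration.E F n x y → Filtration.E F′ m (⟦ f ⟧ x) (⟦ f ⟧ y)))
    (i : Hom N (coimage F F′ f))
    (i-uniform : ∀ m → ∃[ n ] (∀ {x y} → Filtration.E FN n x y →
      Filtration.E (coimage-filtration F F′ f f-uniform) m (⟦ i ⟧ x) (⟦ i ⟧ y)))
    (K : Pred ∣ M′ ∣ 0ℓ) (K-polishable : Polishable (filtrationPolish F′) K)
    (K≐ : K ≐ λ y → ∃[ w ] Module._≈ᴹ_ M′ (⟦ f ⟧ (⟦ i ⟧ w)) y)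
    where

    ambient : PolishCover R
    ambient = record
      { cover = filtrationPolish F′ ; N = K ; polishable = K-polishable }

    private
      F″ = coimage-filtration F F′ f f-uniform
      module G = Module (coimage F F′ f)
      module FN = Filtration FN

    cover : PolishCover R
    cover = record
      { cover = filtrationPolish F″
      ; N = Image i
      ; polishable = image-polishable FN F″ i i-uniform
      }

    -- The coimage carries the Polish topology of the image of f. Its equality is equality of images
    -- under f, so `same-N` is just `K≐`.
    subCover : SubCover ambient
    subCover = record
      { sub = cover
      ; ι = proj₁ (proj₂ (image-polishable F F′ f f-uniform))
      ; contains = λ y∈K → let (w , e) = proj₁ K≐ y∈K in ⟦ i ⟧ w , e
      ; same-N = proj₂ K≐ , proj₁ K≐
      }

    module _ (em : ExcludedMiddle 0ℓ) {L : Mod R} (FL : Filtration L)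
      (j : Hom L (coimage F F′ f))
      (j-uniform : ∀ m → ∃[ n ] (∀ {x y} →
        Filtration.E FL n x y → Filtration.E F″ m (⟦ j ⟧ x) (⟦ j ⟧ y)))
      (i⊆j : Image i ⊆ Image j)
      (j≐approximable : Image j ≐ Approximable em FN F″ i)
      (approximate : ∀ l k → ∃[ a ] (∀ k₁ b → k ≤ k₁ → FN.E k a b →
        ∃[ l′ ] (Filtration.E FL k l l′ × (∀ {l″} → Filtration.E FL k₁ l′ l″ → ∀ m →
          ∃[ u ] (FN.E k₁ b u × Filtration.E F″ m (⟦ j ⟧ l″) (⟦ i ⟧ u))))))
      where

      -- `Approximable-Π⁰₃` bounds the complexity and `Image⊆Π⁰₃` gives minimality; the Polishable
      -- presentation of a competitor H supplies its closure under equality and addition.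
      isS₁ : IsS₁ cover (Image j)
      isS₁ = ((image-polishable FL F″ j j-uniform , i⊆j) , Π⁰₃-resp-≐ (Approximable-Π⁰₃ em FN F″ i))
        , λ H (((Q , h , H≐) , i⊆H) , H-Π⁰₃) →
          Image⊆Π⁰₃ em FN F″ i FL j
            (λ x m → let (n , c) = i-uniform m in n , c) approximate H-Π⁰₃
            (λ e Hx → let (q , d) = proj₁ H≐ Hx in proj₂ H≐ (q , G.≈ᴹ-trans d e))
            (λ Hx Hy → let (q , d) = proj₁ H≐ Hx
                           (r , c) = proj₁ H≐ Hy
                       in proj₂ H≐ (_ , G.≈ᴹ-trans (Hom.+ᴹ-homo (ContinuousInjection.hom h) q r)
                                          (G.+ᴹ-cong d c)))
            i⊆H
        where
        Π⁰₃-resp-≐ : Π⁰₃ (Filtration.FOpen F″) (Approximable em FN F″ i) →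
                     Π⁰₃ (Filtration.FOpen F″) (Image j)
        Π⁰₃-resp-≐ (S , Σ₂ , ⊆S , S⊆) = S , Σ₂
          , (λ x → ⊆S (proj₁ j≐approximable x)) , (λ h → proj₂ j≐approximable (S⊆ h))

  -- Subtowers, and s₁ as one derivation step.

  ⟨module⟩-countable : (M N : Mod R) → Countable (Module._≈ᴹ_ M) → Countable (Module._≈ᴹ_ N) →
                       Countable (Module._≈ᴹ_ (⟨module⟩ M N))
  ⟨module⟩-countable M N (e , e-onto) (f , f-onto) =
    (λ n → e (proj₁ (unpair n)) , f (proj₂ (unpair n))) , λ (x , y) →
      let (a , p) = e-onto x
          (b , q) = f-onto y
          (n , eq) = unpair-surjective a b
      in n , subst (λ u → Module._≈ᴹ_ M (e (proj₁ u)) x × Module._≈ᴹ_ N (f (proj₂ u)) y)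
        (sym eq) (p , q)

  record Subtower (T : Tower R) : Set₁ where
    open Tower T
    field
      part           : ∀ n → Submodule (A n)
      p-mem          : ∀ n {x} → Submodule.Mem (part (suc n)) x →
                       Submodule.Mem (part n) (⟦ p n ⟧ x)
      part-countable : ∀ n → Countable (Module._≈ᴹ_ (toModule (part n)))

    Member : ∀ n → Pred ∣ A n ∣ 0ℓ
    Member n = Submodule.Mem (part n)

  module _ (T : Tower R) where

    open Tower T

    private
      module A n = Module (A n)
      module p n = Hom (p n)
      FA = ∏-filtration A countable

    module _ (B : Subtower T) where

      open Subtower B

      -- Representatives (x , w) of the elements x + δ w of ∏ B + δ (∏ A).
      pairs : ℕ → Mod R
      pairs n = ⟨module⟩ (toModule (part n)) (A n)

      pairs-filtration : Filtration (∏ pairs)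
      pairs-filtration = ∏-filtration pairs λ n →
        ⟨module⟩-countable (toModule (part n)) (A n) (part-countable n) (countable n)

      fst : ∣ ∏ pairs ∣ → ∣ ∏ A ∣
      fst x n = proj₁ (proj₁ (x n))

      snd : ∣ ∏ pairs ∣ → ∣ ∏ A ∣
      snd x n = proj₂ (x n)

      pairSum : Hom (∏ pairs) (∏ A)
      pairSum = mkHom (λ x n → A._+ᴹ_ n (fst x n) (δ T (snd x) n))
        (λ e n → A.+ᴹ-cong n (proj₁ (e n)) (δ.⟦⟧-cong T (λ i → proj₂ (e i)) n))
        (λ x y n → A.≈ᴹ-trans n (A.+ᴹ-congˡ n (δ.+ᴹ-homo T (snd x) (snd y) n))
          (solve-group (A.+ᴹ-abelianGroup n)
            ((var 0F ⊕ var 1F) ⊕ (var 2F ⊕ var 3F)) ((var 0F ⊕ var 2F) ⊕ (var 1F ⊕ var 3F)) refl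
            (fst x n ∷ fst y n ∷ δ T (snd x) n ∷ δ T (snd y) n ∷ [])))
        (λ r x n → A.≈ᴹ-trans n (A.+ᴹ-congˡ n (δ.*ₗ-homo T r (snd x) n))
          (A.≈ᴹ-sym n (A.*ₗ-distribˡ n r (fst x n) (δ T (snd x) n))))

      pairSum-uniform : ∀ m → ∃[ n ] (∀ {x y} → Filtration.E pairs-filtration n x y →
                          Filtration.E FA m (⟦ pairSum ⟧ x) (⟦ pairSum ⟧ y))
      pairSum-uniform m = suc m , λ e i i<m → A.+ᴹ-cong i (proj₁ (e i (ℕₚ.m<n⇒m<1+n i<m)))
        (minus-cong (A i) (proj₂ (e i (ℕₚ.m<n⇒m<1+n i<m)))
          (p.⟦⟧-cong i (proj₂ (e (suc i) (s≤s i<m)))))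

      -- This is δ, factored through ∏ B + δ (∏ A).
      coboundary : Hom (∏ A) (coimage pairs-filtration FA pairSum)
      coboundary = mkHom (λ w n → (A.0ᴹ n , Submodule.0-mem (part n)) , w n)
        (λ e n → A.+ᴹ-congˡ n (δ.⟦⟧-cong T e n))
        (λ w w′ n → A.+ᴹ-congʳ n (A.≈ᴹ-sym n (A.+ᴹ-identityˡ n (A.0ᴹ n))))
        (λ r w n → A.+ᴹ-congʳ n (A.≈ᴹ-sym n (A.*ₗ-zeroʳ n r)))

      -- The image of lim¹ B in lim¹ A, presented as (∏ B + δ (∏ A)) / δ (∏ A).
      module Sums = ImageCover pairs-filtration FA FA pairSum pairSum-uniform coboundary
        (λ m → m , λ {x} e → ⟦ coboundary ⟧ x , (λ n → A.≈ᴹ-refl n) , λ n n<m → A.≈ᴹ-refl n , e n n<m)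
        (Image (difference T)) (PolishCover.polishable (lim¹ T))
        ( (λ (w , e) → w , λ n → A.≈ᴹ-trans n (A.+ᴹ-identityˡ n (δ T w n)) (e n))
        , (λ (w , e) → w , λ n → A.≈ᴹ-trans n (A.≈ᴹ-sym n (A.+ᴹ-identityˡ n (δ T w n))) (e n)))

    truncate-mem : (B : Subtower T) → let open Subtower B in
                   ∀ k {x} → (∀ n → Member n (x n)) → ∀ n → Member n (truncate A k x n)
    truncate-mem B k {x} x∈B n with ℕₚ.<-≤-connex n k
    ... | inj₁ n<k rewrite truncate-< A x n<k = x∈B n
    ... | inj₂ k≤n rewrite truncate-≥ A x k≤n = Submodule.0-mem (Subtower.part B n)

    -- The injectivity of lim¹ B → lim¹ A.
    Saturated : Subtower T → Set
    Saturated B = ∀ z → (∀ n → Member n (δ T z n)) → ∀ n → Member n (z n)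
      where open Subtower B

    -- `C-lift` and `lift-C` together say that C n is the intersection over k of the bonding images
    -- of B (k + n).
    module _ (em : ExcludedMiddle 0ℓ) (B C : Subtower T) (saturated : Saturated B)
      (C-lift : ∀ n {x} → Subtower.Member C n x →
        ∀ k → ∃[ y ] (Subtower.Member B (k + n) y × A._≈ᴹ_ n (bond k n y) x))
      (lift-C : ∀ n {x} →
        (∀ k → ∃[ y ] (Subtower.Member B (k + n) y × A._≈ᴹ_ n (bond k n y) x)) →
        Subtower.Member C n x)
      where

      private
        module B n = Submodule (Subtower.part B n)
        module C n = Submodule (Subtower.part C n)
        i = coboundary B

      C⊆B : ∀ n {x} → C.Mem n x → B.Mem n x
      C⊆B n x∈C = let (y , y∈B , e) = C-lift n x∈C 0 in B.resp n e y∈B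

      embed : Hom (∏ (pairs C)) (coimage (pairs-filtration B) FA (pairSum B))
      embed = mkHom (λ x n → (fst C x n , C⊆B n (proj₂ (proj₁ (x n)))) , snd C x n)
        (λ {x} {y} e → Hom.⟦⟧-cong (pairSum C) {x} {y} e)
        (λ x y n → A.≈ᴹ-refl n) (λ r x n → A.≈ᴹ-refl n)

      -- A solution d of δ d = fst l on an initial segment may be changed by any e
      -- with e n = p (e (suc n)) there; C-lift supplies an e that makes d k vanish.
      embed-near-coboundary : ∀ l k (c : ∣ ∏ A ∣) →
        (∀ n → n < k → A._≈ᴹ_ n (δ T c n) (fst C l n)) → A._≈ᴹ_ k (c k) (A.0ᴹ k) →
        ∀ m → ∃[ u ] ((∀ n → n < k → A._≈ᴹ_ n (u n) (A._+ᴹ_ n (snd C l n) (c n)))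
                     × ∃[ l′ ] ((∀ n → A._≈ᴹ_ n (⟦ pairSum B ⟧ l′ n) (⟦ pairSum C ⟧ l n))
                              × (∀ n → n < m → Module._≈ᴹ_ (pairs B n) (l′ n) (⟦ i ⟧ u n))))
      embed-near-coboundary l k c δc≈x ck≈0 m = u , u≈ , l′ , l′≋l , near
        where
        -- This is at least k, where c is prescribed, and at least m, the required precision.
        M = m + k
        x = fst C l
        w = snd C l
        s = backSolve A p x M (A.0ᴹ M)
        s∈C : ∀ n → C.Mem n (s n)
        s∈C = backSolve-mem A p (Subtower.part C) (Subtower.p-mem C) (λ n → proj₂ (proj₁ (l n)))
          M (C.0-mem M)
        -- The lift v of `s k` lives at level M. Solving δ e = 0 below M from e M = v gives e k = s
        -- k, so d = s - e vanishes at k.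
        lifted = C-lift k (s∈C k) m
        v = proj₁ lifted
        e = backSolve A p (λ n → A.0ᴹ n) M v
        e∈B : ∀ n → B.Mem n (e n)
        e∈B = backSolve-mem A p (Subtower.part B) (Subtower.p-mem B) B.0-mem
          M (proj₁ (proj₂ lifted))
        d : ∣ ∏ A ∣
        d n = A._+ᴹ_ n (s n) (A.-ᴹ_ n (e n))
        d∈B : ∀ n → B.Mem n (d n)
        d∈B n = Submodule-minus (A n) (Subtower.part B n) (C⊆B n (s∈C n)) (e∈B n)
        δd≈x : ∀ n → n < M → A._≈ᴹ_ n (δ T d n) (x n)
        δd≈x n n<M = A.≈ᴹ-trans n (δ-minus T s e n) (A.≈ᴹ-trans n
          (minus-cong (A n) (backSolve-step A p x M _ n<M) (backSolve-step A p _ M v n<M))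
          (solve-group (A.+ᴹ-abelianGroup n) (var 0F ⊕ ⊖ nil) (var 0F) refl (x n ∷ [])))
        sk≈ek : A._≈ᴹ_ k (s k) (e k)
        sk≈ek = A.≈ᴹ-sym k (A.≈ᴹ-trans k
          (δ≈0⇒bond T e m k (λ n n<M → backSolve-step A p _ M v n<M))
          (A.≈ᴹ-trans k (Hom.⟦⟧-cong (bondHom T m k)
              (A.≈ᴹ-reflexive M (backSolve-end A p _ M v)))
            (proj₂ (proj₂ lifted))))
        dk≈ck : A._≈ᴹ_ k (d k) (c k)
        dk≈ck = A.≈ᴹ-trans k (A.+ᴹ-congʳ k sk≈ek)
          (A.≈ᴹ-trans k (A.-ᴹ‿inverseʳ k (e k)) (A.≈ᴹ-sym k ck≈0))
        d≈c : ∀ n → n < k → A._≈ᴹ_ n (d n) (c n)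
        d≈c = δ-unique T d c k (λ n n<k → A.≈ᴹ-trans n (δd≈x n (ℕₚ.m≤n⇒m≤o+n m n<k))
          (A.≈ᴹ-sym n (δc≈x n n<k))) dk≈ck
        u : ∣ ∏ A ∣
        u n = A._+ᴹ_ n (w n) (d n)
        u≈ : ∀ n → n < k → A._≈ᴹ_ n (u n) (A._+ᴹ_ n (w n) (c n))
        u≈ n n<k = A.+ᴹ-congˡ n (d≈c n n<k)
        -- Moving δ d into the second component keeps the sum, and the first component x - δ d
        -- vanishes below M. Only membership of d in B is at hand, so this is a representative for
        -- B, not for C.
        l′ : ∣ ∏ (pairs B) ∣
        l′ n = (A._+ᴹ_ n (x n) (A.-ᴹ_ n (δ T d n))
          , Submodule-minus (A n) (Subtower.part B n) (C⊆B n (proj₂ (proj₁ (l n))))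
              (Submodule-minus (A n) (Subtower.part B n) (d∈B n)
                (Subtower.p-mem B n (d∈B (suc n)))))
          , u n
        l′≋l : ∀ n → A._≈ᴹ_ n (⟦ pairSum B ⟧ l′ n) (⟦ pairSum C ⟧ l n)
        l′≋l n = A.≈ᴹ-trans n (A.+ᴹ-congˡ n (δ.+ᴹ-homo T w d n))
          (solve-group (A.+ᴹ-abelianGroup n)
            ((var 0F ⊕ ⊖ var 1F) ⊕ (var 2F ⊕ var 1F)) (var 0F ⊕ var 2F) refl
            (x n ∷ δ T d n ∷ δ T w n ∷ []))
        near : ∀ n → n < m → Module._≈ᴹ_ (pairs B n) (l′ n) (⟦ i ⟧ u n)
        near n n<m = A.≈ᴹ-trans n
            (A.+ᴹ-congˡ n (A.-ᴹ‿cong n (δd≈x n (ℕₚ.<-≤-trans n<m (ℕₚ.m≤m+n m k)))))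
            (A.-ᴹ‿inverseʳ n (x n))
          , A.≈ᴹ-refl n

      private
        FB = coimage-filtration (pairs-filtration B) FA (pairSum B) (pairSum-uniform B)

      embed⊆Approximable : Image embed ⊆ Approximable em FA FB i
      embed⊆Approximable {y} (l , e) k = a , near
        where
        c = truncated-preimage T (fst C l) k
        a : ∣ ∏ A ∣
        a n = A._+ᴹ_ n (snd C l n) (c n)
        near : ∀ m → ∃[ u ] (Filtration.E FA k a u × Filtration.E FB m y (⟦ i ⟧ u))
        near m with embed-near-coboundary l k c (λ n n<k → backSolve-step A p (fst C l) k _ n<k)
                      (backSolve-≥ A p (fst C l) (ℕₚ.≤-refl {k})) m
        ... | u , u≈a , l′ , l′≋l , l′≈ = u , (λ n n<k → A.≈ᴹ-sym n (u≈a n n<k))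
            , l′ , (λ n → A.≈ᴹ-trans n (l′≋l n) (e n)) , l′≈

      -- Let y = x + δ w. The approximations of y yield d in B with δ d = x on long initial
      -- segments, where the first k coordinates of d depend only on `a k`. Reading these off gives
      -- b, and x - δ b lies in C because differences of the d's lift arbitrarily far.
      Approximable⊆embed : Approximable em FA FB i ⊆ Image embed
      Approximable⊆embed {y} approx = l , l≋y
        where
        x = fst B y
        w = snd B y
        a : ∀ k → ∣ ∏ A ∣
        a k = proj₁ (approx k)
        approximation : ∀ k m → ∃[ d ] ((∀ n → B.Mem n (d n))
          × (∀ n → n < k → n < m → A._≈ᴹ_ n (d n) (A._+ᴹ_ n (a k n) (A.-ᴹ_ n (w n))))
          × (∀ n → n < m → A._≈ᴹ_ n (δ T d n) (x n)))
        approximation k m with proj₂ (approx k) m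
        -- Comparing l′ with y gives δ d = x - `fst B l′`, which lies in B, so saturation puts d
        -- itself into B.
        ... | u , a≈u , l′ , l′≋y , l′≈ = d , saturated d δd∈B
            , (λ n n<k n<m → A.+ᴹ-congʳ n
                (A.≈ᴹ-trans n (proj₂ (l′≈ n n<m)) (A.≈ᴹ-sym n (a≈u n n<k))))
            , λ n n<m → A.≈ᴹ-trans n (δd≈ n) (A.≈ᴹ-trans n
                (minus-cong (A n) (A.≈ᴹ-refl n) (proj₁ (l′≈ n n<m)))
                (solve-group (A.+ᴹ-abelianGroup n) (var 0F ⊕ ⊖ nil) (var 0F) refl (x n ∷ [])))
          where
          d : ∣ ∏ A ∣
          d n = A._+ᴹ_ n (snd B l′ n) (A.-ᴹ_ n (w n))
          δd≈ : ∀ n → A._≈ᴹ_ n (δ T d n) (A._+ᴹ_ n (x n) (A.-ᴹ_ n (fst B l′ n)))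
          δd≈ n = begin
            δ T d n
              ≈⟨ δ-minus T (snd B l′) w n ⟩
            A._+ᴹ_ n z′ (A.-ᴹ_ n z)
              ≈⟨ solve-group (A.+ᴹ-abelianGroup n)
                   (var 1F ⊕ ⊖ var 2F) ((var 0F ⊕ var 1F) ⊕ ⊖ (var 0F ⊕ var 2F)) refl
                   (fst B l′ n ∷ z′ ∷ z ∷ []) ⟩
            A._+ᴹ_ n (A._+ᴹ_ n (fst B l′ n) z′) (A.-ᴹ_ n (A._+ᴹ_ n (fst B l′ n) z))
              ≈⟨ A.+ᴹ-congʳ n (l′≋y n) ⟩
            A._+ᴹ_ n (A._+ᴹ_ n (x n) z) (A.-ᴹ_ n (A._+ᴹ_ n (fst B l′ n) z))
              ≈⟨ solve-group (A.+ᴹ-abelianGroup n)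
                   ((var 0F ⊕ var 1F) ⊕ ⊖ (var 2F ⊕ var 1F)) (var 0F ⊕ ⊖ var 2F) refl
                   (x n ∷ z ∷ fst B l′ n ∷ []) ⟩
            A._+ᴹ_ n (x n) (A.-ᴹ_ n (fst B l′ n)) ∎
            where
            open SetoidReasoning (A.≈ᴹ-setoid n)
            z′ = δ T (snd B l′) n
            z = δ T w n
          δd∈B : ∀ n → B.Mem n (δ T d n)
          δd∈B n = B.resp n (A.≈ᴹ-sym n (δd≈ n)) (Submodule-minus (A n) (Subtower.part B n)
            (proj₂ (proj₁ (y n))) (proj₂ (proj₁ (l′ n))))
        b : ∣ ∏ A ∣
        -- The centre `a (suc k)` is the first to control coordinate k.
        b k = A._+ᴹ_ k (a (suc k) k) (A.-ᴹ_ k (w k))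
        x₁ : ∣ ∏ A ∣
        x₁ n = A._+ᴹ_ n (x n) (A.-ᴹ_ n (δ T b n))
        x₁∈C : ∀ k → C.Mem k (x₁ k)
        x₁∈C k = lift-C k lift
          where
          lift : ∀ j → ∃[ v ] (B.Mem (j + k) v × A._≈ᴹ_ k (bond j k v) (x₁ k))
          -- Here d k = b k and d′ (k + 1) = b (k + 1), so δ d′ = x at k gives x₁ k = d′ k - d k. As
          -- δ (d′ - d) vanishes below j + k, this is the bonding image of the value at j + k. The
          -- precision covers coordinate k + 1 also for j = 0.
          lift j with approximation (suc k) (suc (suc (j + k)))
                    | approximation (suc (suc k)) (suc (suc (j + k)))
          ... | d , d∈B , d≈ , δd≈x | d′ , d′∈B , d′≈ , δd′≈x =
            e (j + k) , Submodule-minus (A (j + k)) (Subtower.part B (j + k)) (d′∈B _) (d∈B _)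
            , A.≈ᴹ-sym k (A.≈ᴹ-trans k x₁≈e (δ≈0⇒bond T e j k δe≈0))
            where
            e : ∣ ∏ A ∣
            e n = A._+ᴹ_ n (d′ n) (A.-ᴹ_ n (d n))
            k<M : k < suc (suc (j + k))
            k<M = s≤s (ℕₚ.m≤n⇒m≤1+n (ℕₚ.m≤n+m k j))
            δe≈0 : ∀ n → n < j + k → A._≈ᴹ_ n (δ T e n) (A.0ᴹ n)
            δe≈0 n n<j+k = A.≈ᴹ-trans n (δ-minus T d′ d n) (A.≈ᴹ-trans n
              (minus-cong (A n) (δd′≈x n n<M) (δd≈x n n<M)) (A.-ᴹ‿inverseʳ n (x n)))
              where n<M = ℕₚ.m<n⇒m<1+n (ℕₚ.m<n⇒m<1+n n<j+k)
            x₁≈e : A._≈ᴹ_ k (x₁ k) (e k)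
            x₁≈e = begin
              x₁ k
                ≈⟨ minus-cong (A k) (δd′≈x k k<M) (minus-cong (A k) (d≈ k (ℕₚ.n<1+n k) k<M)
                     (p.⟦⟧-cong k (d′≈ (suc k) (ℕₚ.n<1+n (suc k))
                       (s≤s (s≤s (ℕₚ.m≤n+m k j)))))) ⟨
              A._+ᴹ_ k (δ T d′ k) (A.-ᴹ_ k (A._+ᴹ_ k (d k) (A.-ᴹ_ k (⟦ p k ⟧ (d′ (suc k))))))
                ≈⟨ solve-group (A.+ᴹ-abelianGroup k)
                     ((var 0F ⊕ ⊖ var 1F) ⊕ ⊖ (var 2F ⊕ ⊖ var 1F)) (var 0F ⊕ ⊖ var 2F) refl
                     (d′ k ∷ ⟦ p k ⟧ (d′ (suc k)) ∷ d k ∷ []) ⟩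
              e k ∎
              where open SetoidReasoning (A.≈ᴹ-setoid k)
        l : ∣ ∏ (pairs C) ∣
        l n = (x₁ n , x₁∈C n) , A._+ᴹ_ n (w n) (b n)
        l≋y : ∀ n → A._≈ᴹ_ n (⟦ pairSum C ⟧ l n) (⟦ pairSum B ⟧ y n)
        l≋y n = A.≈ᴹ-trans n (A.+ᴹ-congˡ n (δ.+ᴹ-homo T w b n))
          (solve-group (A.+ᴹ-abelianGroup n)
            ((var 0F ⊕ ⊖ var 1F) ⊕ (var 2F ⊕ var 1F)) (var 0F ⊕ var 2F) refl
            (x n ∷ δ T b n ∷ δ T w n ∷ []))

      -- Write l = (x, w), and let δ c be x truncated at k. With a = w + c, the pair (δ c, b - c)
      -- agrees with l below k. Any l″ in its k₁-ball has first component δ c below k₁, and c k₁ =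
      -- 0, so `embed-near-coboundary` at k₁ gives u agreeing with (b - c) + c = b below k₁.
      approximate : ∀ l k → ∃[ a ] (∀ k₁ b → k ≤ k₁ → Filtration.E FA k a b →
        ∃[ l′ ] (Filtration.E (pairs-filtration C) k l l′ ×
          (∀ {l″} → Filtration.E (pairs-filtration C) k₁ l′ l″ → ∀ m →
            ∃[ u ] (Filtration.E FA k₁ b u × Filtration.E FB m (⟦ embed ⟧ l″) (⟦ i ⟧ u)))))
      approximate l k = (λ n → A._+ᴹ_ n (snd C l n) (c n)) , λ k₁ b k≤k₁ a≈b → l′ b
          , (λ n n<k → A.≈ᴹ-reflexive n (sym (truncate-< A (fst C l) n<k))
             , A.≈ᴹ-trans n (solve-group (A.+ᴹ-abelianGroup n)
                 (var 0F) ((var 0F ⊕ var 1F) ⊕ ⊖ var 1F) refl (snd C l n ∷ c n ∷ []))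
               (A.+ᴹ-congʳ n (a≈b n n<k)))
          , λ {l″} → near k₁ b k≤k₁ {l″}
        where
        c = truncated-preimage T (fst C l) k
        l′ : ∣ ∏ A ∣ → ∣ ∏ (pairs C) ∣
        l′ b n = (truncate A k (fst C l) n , truncate-mem C k (λ i → proj₂ (proj₁ (l i))) n)
               , A._+ᴹ_ n (b n) (A.-ᴹ_ n (c n))
        near : ∀ k₁ b → k ≤ k₁ → ∀ {l″} → Filtration.E (pairs-filtration C) k₁ (l′ b) l″ → ∀ m →
               ∃[ u ] (Filtration.E FA k₁ b u × Filtration.E FB m (⟦ embed ⟧ l″) (⟦ i ⟧ u))
        near k₁ b k≤k₁ {l″} e m with embed-near-coboundary l″ k₁ c
          (λ n n<k₁ → A.≈ᴹ-trans n (δ-truncated-preimage T (fst C l) k n) (proj₁ (e n n<k₁)))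
          (backSolve-≥ A p (fst C l) k≤k₁) m
        ... | u , u≈ , l‴ , l‴≋l″ , l‴≈ = u
          , (λ n n<k₁ → A.≈ᴹ-sym n (A.≈ᴹ-trans n (u≈ n n<k₁) (A.≈ᴹ-trans n
              (A.+ᴹ-congʳ n (A.≈ᴹ-sym n (proj₂ (e n n<k₁))))
              (solve-group (A.+ᴹ-abelianGroup n)
                 ((var 0F ⊕ ⊖ var 1F) ⊕ var 1F) (var 0F) refl (b n ∷ c n ∷ [])))))
          , l‴ , l‴≋l″ , l‴≈

      Image-embed-isS₁ : IsS₁ (Sums.cover B) (Image embed)
      Image-embed-isS₁ = Sums.isS₁ B em (pairs-filtration C) embed
        (λ m → m , λ {x} e → ⟦ embed ⟧ x , (λ n → A.≈ᴹ-refl n) , e)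
        (λ (w , e) → (λ n → (A.0ᴹ n , C.0-mem n) , w n) , e)
        ((λ {y} → embed⊆Approximable {y}) , (λ {y} → Approximable⊆embed {y}))
        approximate

-- Ordinals and their fundamental sequences.

module _ (O : CountableOrdinals) (F : FundamentalSequences O) where

  open CountableOrdinals O
  open FundamentalSequences F

  infix 4 _≼_
  _≼_ : Ord → Ord → Set
  β ≼ α = β ≺ α ⊎ β ≡ α

  ⋖-unique : ∀ {α β γ} → β ⋖ α → γ ⋖ α → β ≡ γ
  ⋖-unique {α} {β} {γ} (β≺α , β-max) (γ≺α , γ-max) with compare β γ
  ... | tri< β≺γ _ _ = ⊥-elim (β-max γ β≺γ γ≺α)
  ... | tri≈ _ β≡γ _ = β≡γ
  ... | tri> _ _ γ≺β = ⊥-elim (γ-max β γ≺β β≺α)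

  successor⇒¬limit : ∀ {α β} → β ⋖ α → ¬ IsLimit α
  successor⇒¬limit β⋖α (_ , ¬successor) = ¬successor _ β⋖α

  module _ (em : ExcludedMiddle 0ℓ) where

    zero⊎successor : ∀ {α} → ¬ IsLimit α → IsZero α ⊎ ∃[ β ] β ⋖ α
    zero⊎successor {α} ¬lim with em {IsZero α} | em {∃[ β ] β ⋖ α}
    ... | yes z | _     = inj₁ z
    ... | no _  | yes s = inj₂ s
    ... | no ¬z | no ¬s = ⊥-elim (¬lim (¬z , λ β β⋖α → ¬s (β , β⋖α)))

    []-¬limit : ∀ α n → ¬ IsLimit (α [ n ])
    []-¬limit α n with em {IsLimit α}
    ... | yes lim = successor⇒¬limit (proj₂ (successor n lim))
    ... | no ¬lim = subst (λ β → ¬ IsLimit β) (sym (constant n ¬lim)) ¬lim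

    []-≺ : ∀ {α β} n → β ≺ α → β [ n ] ≺ α
    []-≺ {α} {β} n β≺α with em {IsLimit β}
    ... | yes lim = ≺-trans (below n lim) β≺α
    ... | no ¬lim = subst (_≺ α) (sym (constant n ¬lim)) β≺α

    []-mono : ∀ α {m n} → m ≤ n → α [ m ] ≼ α [ n ]
    []-mono α {m} {n} m≤n with em {IsLimit α}
    ... | no ¬lim = inj₂ (trans (constant m ¬lim) (sym (constant n ¬lim)))
    ... | yes lim = increase n m≤n
      where
      increase : ∀ n → m ≤ n → α [ m ] ≼ α [ n ]
      increase n m≤n with ℕₚ.m≤n⇒m<n∨m≡n m≤n
      ... | inj₂ refl = inj₂ refl
      increase (suc n) m≤n | inj₁ (s≤s m≤n′) with increase n m≤n′
      ... | inj₁ lt = inj₁ (≺-trans lt (increasing n lim))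
      ... | inj₂ eq = inj₁ (subst (_≺ α [ suc n ]) (sym eq) (increasing n lim))

    -- If β is a limit then γ differs from it, and cofinality applies; otherwise the sequence is
    -- constant.
    ≼-[] : ∀ {β γ} → ¬ IsLimit γ → γ ≼ β → ∃[ n ] γ ≼ β [ n ]
    ≼-[] {β} {γ} ¬lim γ≼β with em {IsLimit β}
    ... | no ¬limβ = 0 , subst (γ ≼_) (sym (constant 0 ¬limβ)) γ≼β
    ≼-[] ¬lim (inj₂ refl) | yes limβ = ⊥-elim (¬lim limβ)
    ≼-[] {γ = γ} ¬lim (inj₁ γ≺β) | yes limβ = let (n , lt) = cofinal γ limβ γ≺β in n , inj₁ lt

    -- Saturation and successor steps of derived towers.

    module _ {R : CommutativeRing 0ℓ 0ℓ} (T : Tower R) where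

      open Tower T

      private
        module A n = Module (A n)
        module p n = Hom (p n)
        module bond k n = Hom (bondHom T k n)

      D : Ord → (n : ℕ) → Pred ∣ A n ∣ 0ℓ
      D = Derived F T

      derivedSubtower : Ord → Subtower T
      derivedSubtower α = record
        { part = derivedSubmodule F T em α
        ; p-mem = λ n d → proj₂ (⟦ Tower.p (derived F T em α) n ⟧ (_ , d))
        ; part-countable = Tower.countable (derived F T em α)
        }

      module _ {γ : Ord} (¬lim : ¬ IsLimit γ) where

        private
          to : ∀ {n x} → D γ n x → D (γ [ n ]) n x
          to {n} {x} = subst (λ β → D β n x) (sym (constant n ¬lim))

          from : ∀ {n x} → D (γ [ n ]) n x → D γ n x
          from {n} {x} = subst (λ β → D β n x) (constant n ¬lim)

        D-submodule : ∀ n → Submodule (A n)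
        D-submodule n = record
          { Mem = D γ n
          ; resp = λ e d → from (S.resp e (to d))
          ; 0-mem = from S.0-mem
          ; +-mem = λ d d′ → from (S.+-mem (to d) (to d′))
          ; neg-mem = λ d → from (S.neg-mem (to d))
          ; *ₗ-mem = λ r d → from (S.*ₗ-mem r (to d))
          }
          where module S = Submodule (derivedSubmodule F T em γ n)

        D-p : ∀ n {x} → D γ (suc n) x → D γ n (⟦ p n ⟧ x)
        D-p n d = from (Subtower.p-mem (derivedSubtower γ) n (to d))

        D-bond : ∀ k n {x} → D γ (k + n) x → D γ n (bond k n x)
        D-bond zero    n d = d
        D-bond (suc k) n d = D-bond k n (D-p (k + n) d)

        D-partial-bond : ∀ n {k K y} → k ≤ K → D γ (K + n) y →
                         ∃[ y′ ] (D γ (k + n) y′ × A._≈ᴹ_ n (bond k n y′) (bond K n y))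
        D-partial-bond n {k} {K} k≤K d with ℕₚ.m≤n⇒m<n∨m≡n k≤K
        ... | inj₂ refl = _ , d , A.≈ᴹ-refl n
        D-partial-bond n {k} {suc K} k≤K d | inj₁ (s≤s k≤K′) =
          D-partial-bond n k≤K′ (D-p (K + n) d)

      D-pred : ∀ {α β} n {x} → β ⋖ α → D α n x →
               ∀ k → ∃[ y ] (D (β [ k ]) (k + n) y × A._≈ᴹ_ n (bond k n y) x)
      D-pred n β⋖α (zeroᵈ z) = ⊥-elim (z _ (proj₁ β⋖α))
      D-pred n β⋖α (sucᵈ γ⋖α f) with ⋖-unique β⋖α γ⋖α
      ... | refl = f

      -- For α = β + 1 and γ below α there is k with γ ≼ β [ k ]. The k-th witness bonds down to x,
      -- which puts x into A_(β [ k ]), and induction applies there.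
      D-antitone : ∀ {γ α} n {x} → ¬ IsLimit γ → γ ≼ α → D α n x → D γ n x
      D-antitone {α = α} n ¬lim γ≼α d = go (wellFounded α) ¬lim γ≼α d
        where
        go : ∀ {γ α x} → Acc _≺_ α → ¬ IsLimit γ → γ ≼ α → D α n x → D γ n x
        go _ ¬lim (inj₂ refl) d = d
        go _ ¬lim (inj₁ γ≺α) (zeroᵈ z) = ⊥-elim (z _ γ≺α)
        go {γ} (acc rec) ¬lim (inj₁ γ≺α) (sucᵈ {β = β} (β≺α , β-max) f)
          with ≼-[] ¬lim γ≼β
          where
          γ≼β : γ ≼ β
          γ≼β with compare γ β
          ... | tri< γ≺β _ _ = inj₁ γ≺β
          ... | tri≈ _ γ≡β _ = inj₂ γ≡β
          ... | tri> _ _ β≺γ = ⊥-elim (β-max γ β≺γ γ≺α)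
        ... | k , γ≼βk = let (y , d , e) = f k in
          go (rec ([]-≺ k β≺α)) ¬lim γ≼βk
            (Submodule.resp (D-submodule ([]-¬limit β k) n) e (D-bond ([]-¬limit β k) k n d))

      -- The difference z n - p^k (z (k + n)) telescopes into bonding images of δ z. The hypothesis
      -- is restricted to m ≥ n so that the induction can restart at level k + n with the smaller
      -- ordinal β [ k ].
      D-saturated : ∀ {γ} → ¬ IsLimit γ → ∀ z n → (∀ m → n ≤ m → D γ m (δ T z m)) → D γ n (z n)
      D-saturated {γ} ¬lim z n = go (wellFounded γ) ¬lim n
        where
        go : ∀ {γ} → Acc _≺_ γ → ¬ IsLimit γ → ∀ n → (∀ m → n ≤ m → D γ m (δ T z m)) → D γ n (z n)
        go {γ} (acc rec) ¬lim n δz∈D with zero⊎successor ¬lim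
        ... | inj₁ isZero = zeroᵈ isZero
        ... | inj₂ (β , β⋖γ) = sucᵈ β⋖γ lift
          where
          module Dγ = Submodule (D-submodule ¬lim n)
          z-bond : ∀ k → D γ n (A._+ᴹ_ n (z n) (A.-ᴹ_ n (bond k n (z (k + n)))))
          z-bond zero    = Dγ.resp (A.≈ᴹ-sym n (A.-ᴹ‿inverseʳ n (z n))) Dγ.0-mem
          z-bond (suc k) = Dγ.resp eq
            (Dγ.+-mem (z-bond k) (D-bond ¬lim k n (δz∈D (k + n) (ℕₚ.m≤n+m n k))))
            where
            eq : A._≈ᴹ_ n
              (A._+ᴹ_ n (A._+ᴹ_ n (z n) (A.-ᴹ_ n (bond k n (z (k + n))))) (bond k n (δ T z (k + n))))
              (A._+ᴹ_ n (z n) (A.-ᴹ_ n (bond (suc k) n (z (suc k + n)))))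
            eq = A.≈ᴹ-trans n
              (A.+ᴹ-congˡ n (A.≈ᴹ-trans n (bond.+ᴹ-homo k n _ _) (A.+ᴹ-congˡ n (bond.-ᴹ-homo k n _))))
              (solve-group (A.+ᴹ-abelianGroup n)
                ((var 0F ⊕ ⊖ var 1F) ⊕ (var 1F ⊕ ⊖ var 2F)) (var 0F ⊕ ⊖ var 2F) refl
                (z n ∷ bond k n (z (k + n)) ∷ bond (suc k) n (z (suc k + n)) ∷ []))
          lift : ∀ k → ∃[ y ] (D (β [ k ]) (k + n) y × A._≈ᴹ_ n (bond k n y) (z n))
          lift k with D-pred n β⋖γ (z-bond k) k
          ... | u , u∈D , e = A._+ᴹ_ (k + n) u (z (k + n))
            , Submodule.+-mem (D-submodule ([]-¬limit β k) (k + n)) u∈D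
                (go (rec βk≺γ) ([]-¬limit β k) (k + n) λ m k+n≤m →
                  D-antitone m ([]-¬limit β k) (inj₁ βk≺γ)
                    (δz∈D m (ℕₚ.≤-trans (ℕₚ.m≤n+m n k) k+n≤m)))
            , A.≈ᴹ-trans n (bond.+ᴹ-homo k n u (z (k + n))) (A.≈ᴹ-trans n (A.+ᴹ-congʳ n e)
                (solve-group (A.+ᴹ-abelianGroup n)
                  ((var 0F ⊕ ⊖ var 1F) ⊕ var 1F) (var 0F) refl (z n ∷ bond k n (z (k + n)) ∷ [])))
            where
            βk≺γ : β [ k ] ≺ γ
            βk≺γ = []-≺ k (proj₁ β⋖γ)

      derived-saturated : ∀ α → Saturated T (derivedSubtower α)
      derived-saturated α z δz∈D n = D-saturated ([]-¬limit α n) z n λ m n≤m →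
        D-antitone m ([]-¬limit α n) ([]-mono α n≤m) (δz∈D m)

      -- `Derived` provides index β [ k ] at level k + n, but the tower A_β has index β [ k + n ]
      -- there. So lift by k + n levels and bond back down to level k + n.
      derived-lift : ∀ {α β} → β ⋖ α → ∀ n {x} → Subtower.Member (derivedSubtower α) n x →
        ∀ k → ∃[ y ] (Subtower.Member (derivedSubtower β) (k + n) y × A._≈ᴹ_ n (bond k n y) x)
      derived-lift {α} {β} β⋖α n {x} d k
        with D-pred n β⋖α (subst (λ γ → D γ n x) (constant n (successor⇒¬limit β⋖α)) d) (k + n)
      ... | y , d′ , e with D-partial-bond ([]-¬limit β (k + n)) n (ℕₚ.m≤m+n k n) d′
      ...   | y′ , d″ , e′ = y′ , d″ , A.≈ᴹ-trans n e′ e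

      lift-derived : ∀ {α β} → β ⋖ α → ∀ n {x} →
        (∀ k → ∃[ y ] (Subtower.Member (derivedSubtower β) (k + n) y × A._≈ᴹ_ n (bond k n y) x)) →
        Subtower.Member (derivedSubtower α) n x
      lift-derived {α} {β} β⋖α n {x} lift =
        subst (λ γ → D γ n x) (sym (constant n (successor⇒¬limit β⋖α))) (sucᵈ β⋖α λ k →
          let (y , d , e) = lift k in
          y , D-antitone (k + n) ([]-¬limit β k) ([]-mono β (ℕₚ.m≤m+n k n)) d , e)

      -- If δ z = x - y with x and y in A_α, then saturation puts z into A_α.
      inclusion-injective : ∀ α → lim¹-inclusion-injective F T em α
      inclusion-injective α x y (z , e) = (λ n → z n , derived-saturated α z δz∈D n) , e
        where
        δz∈D : ∀ n → D (α [ n ]) n (δ T z n)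
        δz∈D n = Submodule.resp (derivedSubmodule F T em α n) (A.≈ᴹ-sym n (e n))
          (Submodule-minus (A n) (derivedSubmodule F T em α n) (proj₂ (x n)) (proj₂ (y n)))

      inclusion-image≐pairSum : ∀ α →
        lim¹-inclusion-image F T em α ≐ Image (pairSum T (derivedSubtower α))
      inclusion-image≐pairSum α =
          (λ {y} (x , z , e) → (λ n → x n , A.-ᴹ_ n (z n)) , λ n →
            A.≈ᴹ-trans n (A.+ᴹ-congˡ n (A.≈ᴹ-trans n (δ.-ᴹ-homo T z n) (A.-ᴹ‿cong n (e n))))
              (solve-group (A.+ᴹ-abelianGroup n) (var 0F ⊕ ⊖ (var 0F ⊕ ⊖ var 1F)) (var 1F) refl
                (proj₁ (x n) ∷ y n ∷ [])))
        , (λ {y} (l , e) → (λ n → proj₁ (l n)) , (λ n → A.-ᴹ_ n (proj₂ (l n))) , λ n →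
            let x = proj₁ (proj₁ (l n))
                w = δ T (λ i → proj₂ (l i)) n
            in A.≈ᴹ-trans n (δ.-ᴹ-homo T (λ i → proj₂ (l i)) n) (A.≈ᴹ-trans n
              (solve-group (A.+ᴹ-abelianGroup n) (⊖ var 1F) (var 0F ⊕ ⊖ (var 0F ⊕ var 1F)) refl
                (x ∷ w ∷ []))
              (A.+ᴹ-congˡ n (A.-ᴹ‿cong n (e n)))))

      -- The zero, limit and successor stages of the Solecki hierarchy.

      solecki-zero : ∀ {α} → IsZero α →
                     lim¹-inclusion-image F T em α ≐ PolishCover.ClosureOfZero (lim¹ T)
      solecki-zero {α} isZero = (λ {x} _ → dense x)
        , λ {x} _ → (λ n → x n , zeroᵈ (subst IsZero (sym (constant n λ lim → proj₁ lim isZero)) isZero))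
                  , (λ n → A.0ᴹ n) , λ n → A.≈ᴹ-trans n (δ.0ᴹ-homo T n)
                      (A.≈ᴹ-sym n (A.-ᴹ‿inverseʳ n (x n)))
        where
        dense : ∀ x → PolishCover.ClosureOfZero (lim¹ T) x
        dense x U U-open U-invariant x∈U =
          -- U contains a truncation of x, which is a coboundary and hence equivalent to 0.
          let (k , near) = U-open x∈U in
          U-invariant (truncated-preimage T x k , λ n → A.≈ᴹ-trans n (δ-truncated-preimage T x k n)
              (solve-group (A.+ᴹ-abelianGroup n) (var 0F) (var 0F ⊕ ⊖ nil) refl (truncate A k x n ∷ [])))
            (near λ n n<k → A.≈ᴹ-reflexive n (sym (truncate-< A x n<k)))

      solecki-limit : ∀ {α} → IsLimit α →
        lim¹-inclusion-image F T em α ≐ (λ y → ∀ β → β ≺ α → lim¹-inclusion-image F T em β y)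
      solecki-limit {α} lim = (λ {y} h β β≺α → restrict y h β β≺α) , λ {y} → glue y
        where
        -- Once β ≺ α [ k ], removing the first k coordinates of x, a coboundary, leaves a sequence
        -- that is 0 below k and lies in A_(β [ n ]) at each n ≥ k.
        restrict : ∀ y → lim¹-inclusion-image F T em α y →
                   ∀ β → β ≺ α → lim¹-inclusion-image F T em β y
        restrict y (x , z , e) β β≺α = (λ n → x′ n , x′∈D n) , z′ , λ n → A.≈ᴹ-trans n
            (δ-minus T z c n) (A.≈ᴹ-trans n
              (minus-cong (A n) (e n) (δ-truncated-preimage T x₀ k n))
              (solve-group (A.+ᴹ-abelianGroup n)
                ((var 0F ⊕ ⊖ var 1F) ⊕ ⊖ var 2F) ((var 0F ⊕ ⊖ var 2F) ⊕ ⊖ var 1F) refl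
                (x₀ n ∷ y n ∷ truncate A k x₀ n ∷ [])))
          where
          k = proj₁ (cofinal β lim β≺α)
          x₀ x′ z′ c : ∣ ∏ A ∣
          x₀ n = proj₁ (x n)
          x′ n = A._+ᴹ_ n (x₀ n) (A.-ᴹ_ n (truncate A k x₀ n))
          c = truncated-preimage T x₀ k
          z′ n = A._+ᴹ_ n (z n) (A.-ᴹ_ n (c n))
          eventually-≺ : ∀ n → k ≤ n → β ≺ α [ n ]
          eventually-≺ n k≤n with []-mono α k≤n
          ... | inj₁ lt = ≺-trans (proj₂ (cofinal β lim β≺α)) lt
          ... | inj₂ eq = subst (β ≺_) eq (proj₂ (cofinal β lim β≺α))
          x′∈D : ∀ n → D (β [ n ]) n (x′ n)
          x′∈D n with ℕₚ.<-≤-connex n k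
          ... | inj₁ n<k rewrite truncate-< A x₀ n<k =
            S.resp (A.≈ᴹ-sym n (A.-ᴹ‿inverseʳ n (x₀ n))) S.0-mem
            where module S = Submodule (derivedSubmodule F T em β n)
          ... | inj₂ k≤n rewrite truncate-≥ A x₀ k≤n =
            Submodule-minus (A n) (derivedSubmodule F T em β n)
              (D-antitone n ([]-¬limit β n) (inj₁ ([]-≺ n (eventually-≺ n k≤n))) (proj₂ (x n)))
              (Submodule.0-mem (derivedSubmodule F T em β n))
        -- The diagonal λ n → z n n works, since z (suc n) and z n differ
        -- by an element of the derived tower A_{α[n]}.
        glue : ∀ y → (∀ β → β ≺ α → lim¹-inclusion-image F T em β y) →
               lim¹-inclusion-image F T em α y
        glue y h = (λ n → x n , x∈D n) , (λ n → z n n) , λ n →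
            solve-group (A.+ᴹ-abelianGroup n) (var 0F) ((var 1F ⊕ var 0F) ⊕ ⊖ var 1F) refl
              (δ T (λ i → z i i) n ∷ y n ∷ [])
          where
          ξ z : ℕ → ∣ ∏ A ∣
          ξ k n = proj₁ (proj₁ (h (α [ k ]) (below k lim)) n)
          z k = proj₁ (proj₂ (h (α [ k ]) (below k lim)))
          e : ∀ k n → A._≈ᴹ_ n (δ T (z k) n) (A._+ᴹ_ n (ξ k n) (A.-ᴹ_ n (y n)))
          e k = proj₂ (proj₂ (h (α [ k ]) (below k lim)))
          S : ∀ k n → Submodule (A n)
          S k = D-submodule ([]-¬limit α k)
          ξ∈D : ∀ k n → D (α [ k ]) n (ξ k n)
          ξ∈D k n = subst (λ γ → D γ n (ξ k n)) (constant n ([]-¬limit α k))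
            (proj₂ (proj₁ (h (α [ k ]) (below k lim)) n))
          x : ∣ ∏ A ∣
          x n = A._+ᴹ_ n (y n) (δ T (λ i → z i i) n)
          z-step : ∀ k n → D (α [ k ]) n (A._+ᴹ_ n (z (suc k) n) (A.-ᴹ_ n (z k n)))
          z-step k n = D-saturated ([]-¬limit α k)
            (λ i → A._+ᴹ_ i (z (suc k) i) (A.-ᴹ_ i (z k i))) n λ m _ →
              Submodule.resp (S k m)
                (A.≈ᴹ-sym m (A.≈ᴹ-trans m (δ-minus T (z (suc k)) (z k) m) (A.≈ᴹ-trans m
                  (minus-cong (A m) (e (suc k) m) (e k m))
                  (solve-group (A.+ᴹ-abelianGroup m)
                    ((var 0F ⊕ ⊖ var 1F) ⊕ ⊖ (var 2F ⊕ ⊖ var 1F)) (var 0F ⊕ ⊖ var 2F) refl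
                    (ξ (suc k) m ∷ y m ∷ ξ k m ∷ [])))))
                (Submodule-minus (A m) (S k m)
                  (D-antitone m ([]-¬limit α k) (inj₁ (increasing k lim)) (ξ∈D (suc k) m))
                  (ξ∈D k m))
          x∈D : ∀ n → D (α [ n ]) n (x n)
          -- By `e n n`, x n equals ξ n n - p (z (n + 1) (n + 1) - z n (n + 1)), and both terms lie
          -- in A_(α [ n ]).
          x∈D n = Submodule.resp (S n n) eq (Submodule-minus (A n) (S n n) (ξ∈D n n)
            (D-p ([]-¬limit α n) n (z-step n (suc n))))
            where
            pz pz′ : ∣ A n ∣
            pz = ⟦ p n ⟧ (z n (suc n))
            pz′ = ⟦ p n ⟧ (z (suc n) (suc n))
            eq : A._≈ᴹ_ n (A._+ᴹ_ n (ξ n n) (A.-ᴹ_ n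
                   (⟦ p n ⟧ (A._+ᴹ_ (suc n) (z (suc n) (suc n)) (A.-ᴹ_ (suc n) (z n (suc n)))))))
                 (x n)
            eq = begin
              A._+ᴹ_ n (ξ n n) (A.-ᴹ_ n
                (⟦ p n ⟧ (A._+ᴹ_ (suc n) (z (suc n) (suc n)) (A.-ᴹ_ (suc n) (z n (suc n))))))
                ≈⟨ A.+ᴹ-congˡ n (A.-ᴹ‿cong n (A.≈ᴹ-trans n (p.+ᴹ-homo n _ _)
                     (A.+ᴹ-congˡ n (p.-ᴹ-homo n _)))) ⟩
              A._+ᴹ_ n (ξ n n) (A.-ᴹ_ n (A._+ᴹ_ n pz′ (A.-ᴹ_ n pz)))
                ≈⟨ solve-group (A.+ᴹ-abelianGroup n)
                     (var 0F ⊕ ⊖ (var 1F ⊕ ⊖ var 2F))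
                     (var 3F ⊕ ((var 0F ⊕ ⊖ var 3F) ⊕ (var 2F ⊕ ⊖ var 1F))) refl
                     (ξ n n ∷ pz′ ∷ pz ∷ y n ∷ []) ⟩
              A._+ᴹ_ n (y n) (A._+ᴹ_ n (A._+ᴹ_ n (ξ n n) (A.-ᴹ_ n (y n)))
                (A._+ᴹ_ n pz (A.-ᴹ_ n pz′)))
                ≈⟨ A.+ᴹ-congˡ n (A.+ᴹ-congʳ n (e n n)) ⟨
              A._+ᴹ_ n (y n) (A._+ᴹ_ n (δ T (z n) n) (A._+ᴹ_ n pz (A.-ᴹ_ n pz′)))
                ≈⟨ solve-group (A.+ᴹ-abelianGroup n)
                     (var 3F ⊕ ((var 0F ⊕ ⊖ var 2F) ⊕ (var 2F ⊕ ⊖ var 1F)))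
                     (var 3F ⊕ (var 0F ⊕ ⊖ var 1F)) refl
                     (z n n ∷ pz′ ∷ pz ∷ y n ∷ []) ⟩
              x n ∎
              where open SetoidReasoning (A.≈ᴹ-setoid n)

      solecki : ∀ α → IsSolecki O (lim¹ T) α (lim¹-inclusion-image F T em α)
      solecki α = go (wellFounded α)
        where
        go : ∀ {α} → Acc _≺_ α → IsSolecki O (lim¹ T) α (lim¹-inclusion-image F T em α)
        go {α} (acc rec) with em {IsLimit α}
        ... | yes lim = s-limit lim (λ β _ → lim¹-inclusion-image F T em β)
          (λ β β≺α → go (rec β≺α)) (solecki-limit lim)
        ... | no ¬lim with zero⊎successor ¬lim
        ...   | inj₁ isZero = s-zero isZero (solecki-zero isZero)
        ...   | inj₂ (β , β⋖α) = s-suc β⋖α (go (rec (proj₁ β⋖α)))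
          -- s_β is presented by sums from A_β, and its s₁ by those from A_α; pushed forward to ∏ A,
          -- the latter are the sums representing lim¹ A_α.
          (Sums.subCover T (derivedSubtower β)) (inclusion-image≐pairSum β)
          (Image j)
          (Image-embed-isS₁ T em (derivedSubtower β) (derivedSubtower α)
            (derived-saturated β) (derived-lift β⋖α) (lift-derived β⋖α))
          ( (λ h → let (l , e) = proj₁ (inclusion-image≐pairSum α) h in
                ⟦ j ⟧ l , (l , λ n → A.≈ᴹ-refl n) , e)
          , (λ (x , (l , e) , e′) → proj₂ (inclusion-image≐pairSum α)
              (l , λ n → A.≈ᴹ-trans n (e n) (e′ n))))
          where
          j = embed T em (derivedSubtower β) (derivedSubtower α)
            (derived-saturated β) (derived-lift β⋖α) (lift-derived β⋖α)

theorem7p6 : (em : ∀ {ℓ} → ExcludedMiddle ℓ)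
    (R : CommutativeRing 0ℓ 0ℓ) → IsDomain R → Countable (CommutativeRing._≈_ R) →
    (O : CountableOrdinals) (F : FundamentalSequences O)
    (A : Tower R) (α : CountableOrdinals.Ord O) →
    lim¹-inclusion-injective F A em α ×
    IsSolecki O (lim¹ A) α (lim¹-inclusion-image F A em α)
theorem7p6 em R _ _ O F A α = inclusion-injective O F em A α , solecki O F em A α
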